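{- Let $q=p^r$ be a power of a prime $p$, let $d\ge 1$, and let $M\in\mathbb{F}_q[T]$ be a nonzero polynomial which splits into linear factors over $\mathbb{F}_{q^d}$. Then, inside a fixed algebraic closure of $\mathbb{F}_q(T)$, the cyclotomic function fields satisfy $K_{q,M}\subset K_{q^d,M}$.
   Context: For a power $Q$ of $p$ (here $Q=q$ or $Q=q^d$), the Carlitz action over $\mathbb{F}_Q$ is defined on $u\in\overline{\mathbb{F}_q(T)}$ by $C_Q(T)(u)=Tu+u^{Q}$, extended $\mathbb{F}_Q$-linearly to all $N=\sum a_iT^i\in\mathbb{F}_Q[T]$ by $C_Q(N)(u)=\sum a_i C_Q(T)^{i}(u)$, where $C_Q(T)^i$ denotes the $i$-fold composite. The $N$-torsion $C_Q[N]$ is the set of $u\in\overline{\mathbb{F}_q(T)}$ with $C_Q(N)(u)=0$. The cyclotomic function field $K_{Q,N}$ is the field obtained by adjoining $C_Q[N]$ to $\mathbb{F}_Q(T)$. -}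

module Defs where

open import Algebra.Apartness.Bundles using (HeytingField; HeytingCommutativeRing)
open import Algebra.Bundles using (CommutativeRing)
import Algebra.Properties.Semiring.Exp as Exp
import Algebra.Properties.Semiring.Sum as Sum
open import Data.Fin.Base using (Fin; toℕ)
open import Data.List.Base using (List; []; _∷_; length; lookup; map; foldr)
open import Data.List.Relation.Unary.All using (All)
open import Data.Nat.Base using (ℕ; zero; suc)
open import Data.Nat.GeneralisedArithmetic using (iterate)
open import Data.Product.Base using (∃-syntax; _×_; proj₁)
open import Function.Bundles using (Bijection)
open import Level using (Level; _⊔_) renaming (suc to lsuc)
import Relation.Binary.Construct.On as On
open import Relation.Binary.PropositionalEquality using () renaming (setoid to ≡-setoid)
open import Relation.Unary using (Pred; _∈_; _∪_; ｛_｝)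

-- A field in the classical sense is a HeytingField whose apartness is
-- decidable: then x # y is equivalent to ¬ x ≈ y, and _≈_ is decidable.
module FieldTheory {c ℓ₁ ℓ₂ : Level} (Ω : HeytingField c ℓ₁ ℓ₂) where

  open HeytingField Ω
  open HeytingCommutativeRing heytingCommutativeRing using (commutativeRing)
  open CommutativeRing commutativeRing using (semiring)
  open Exp semiring using (_^_)
  open Sum semiring using (sum)

  record Subfield (ℓ : Level) : Set (c ⊔ ℓ₁ ⊔ lsuc ℓ) where
    field
      ⟦_⟧        : Pred Carrier ℓ
      respects   : ∀ {x y} → x ≈ y → x ∈ ⟦_⟧ → y ∈ ⟦_⟧
      0-closed   : 0# ∈ ⟦_⟧
      1-closed   : 1# ∈ ⟦_⟧
      +-closed   : ∀ {x y} → x ∈ ⟦_⟧ → y ∈ ⟦_⟧ → (x + y) ∈ ⟦_⟧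
      neg-closed : ∀ {x} → x ∈ ⟦_⟧ → (- x) ∈ ⟦_⟧
      *-closed   : ∀ {x y} → x ∈ ⟦_⟧ → y ∈ ⟦_⟧ → (x * y) ∈ ⟦_⟧
      inv-closed : ∀ {x y} → x ∈ ⟦_⟧ → x * y ≈ 1# → y ∈ ⟦_⟧

  open Subfield public using (⟦_⟧)

  HasOrder : ∀ {ℓ} → Subfield ℓ → ℕ → Set (c ⊔ ℓ₁ ⊔ ℓ)
  HasOrder k n =
    Bijection (≡-setoid (Fin n)) (On.setoid setoid (proj₁ {A = Carrier} {B = ⟦ k ⟧}))

  -- The smallest subfield of Ω containing S, generated inductively rather
  -- than as an intersection, which would raise the universe level.
  data Generated {ℓ} (S : Pred Carrier ℓ) : Pred Carrier (c ⊔ ℓ₁ ⊔ ℓ) where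
    gen  : ∀ {x} → x ∈ S → Generated S x
    resp : ∀ {x y} → x ≈ y → Generated S x → Generated S y
    zer  : Generated S 0#
    one  : Generated S 1#
    add  : ∀ {x y} → Generated S x → Generated S y → Generated S (x + y)
    neg  : ∀ {x} → Generated S x → Generated S (- x)
    mul  : ∀ {x y} → Generated S x → Generated S y → Generated S (x * y)
    inv  : ∀ {x y} → Generated S x → x * y ≈ 1# → Generated S y

  generated : ∀ {ℓ} → Pred Carrier ℓ → Subfield (c ⊔ ℓ₁ ⊔ ℓ)
  generated S = record
    { ⟦_⟧        = Generated S
    ; respects   = resp
    ; 0-closed   = zer
    ; 1-closed   = one
    ; +-closed   = add
    ; neg-closed = neg
    ; *-closed   = mul
    ; inv-closed = inv
    }

  adjoin : ∀ {a b} → Subfield a → Pred Carrier b → Subfield (c ⊔ ℓ₁ ⊔ a ⊔ b)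
  adjoin k S = generated (⟦ k ⟧ ∪ S)

  _⟨_⟩ : ∀ {a} → Subfield a → Carrier → Subfield (c ⊔ ℓ₁ ⊔ a)
  k ⟨ t ⟩ = adjoin k ｛ t ｝

  -- a₀ ∷ a₁ ∷ … represents a₀ + a₁X + …; trailing zeros are allowed, so
  -- equality is _≈ₚ_.
  Poly : Set c
  Poly = List Carrier

  coeff : Poly → ℕ → Carrier
  coeff []      _       = 0#
  coeff (a ∷ f) zero    = a
  coeff (a ∷ f) (suc n) = coeff f n

  infix 4 _≈ₚ_
  _≈ₚ_ : Poly → Poly → Set ℓ₁
  f ≈ₚ g = ∀ n → coeff f n ≈ coeff g n

  Nonzero : Poly → Set ℓ₂
  Nonzero f = ∃[ n ] coeff f n # 0#

  Nonconstant : Poly → Set ℓ₂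
  Nonconstant f = ∃[ n ] coeff f (suc n) # 0#

  infixl 6 _+ₚ_
  _+ₚ_ : Poly → Poly → Poly
  []      +ₚ g       = g
  (a ∷ f) +ₚ []      = a ∷ f
  (a ∷ f) +ₚ (b ∷ g) = (a + b) ∷ (f +ₚ g)

  infixl 7 _·ₚ_ _*ₚ_
  _·ₚ_ : Carrier → Poly → Poly
  a ·ₚ f = map (a *_) f

  _*ₚ_ : Poly → Poly → Poly
  []      *ₚ g = []
  (a ∷ f) *ₚ g = (a ·ₚ g) +ₚ (0# ∷ (f *ₚ g))

  eval : Poly → Carrier → Carrier
  eval f x = sum (λ (i : Fin (length f)) → lookup f i * x ^ toℕ i)

  _[X] : ∀ {ℓ} → Subfield ℓ → Pred Poly (c ⊔ ℓ)
  k [X] = All ⟦ k ⟧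

  X-_ : Carrier → Poly
  X- α = - α ∷ 1# ∷ []

  Splits : ∀ {ℓ} → Subfield ℓ → Poly → Set (c ⊔ ℓ₁ ⊔ ℓ)
  Splits k f = ∃[ a ] ∃[ αs ]
    a ∈ ⟦ k ⟧ × All ⟦ k ⟧ αs × f ≈ₚ a ·ₚ foldr _*ₚ_ (1# ∷ []) (map X-_ αs)

  Transcendental : ∀ {ℓ} → Subfield ℓ → Carrier → Set (c ⊔ ℓ₁ ⊔ ℓ)
  Transcendental k t = ∀ f → f ∈ k [X] → eval f t ≈ 0# → f ≈ₚ []

  Algebraic : ∀ {ℓ} → Subfield ℓ → Carrier → Set (c ⊔ ℓ₁ ⊔ ℓ₂ ⊔ ℓ)
  Algebraic k x = ∃[ f ] f ∈ k [X] × Nonzero f × eval f x ≈ 0#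

  AlgebraicallyClosed : Set (c ⊔ ℓ₁ ⊔ ℓ₂)
  AlgebraicallyClosed = ∀ f → Nonconstant f → ∃[ x ] eval f x ≈ 0#

  record IsAlgebraicClosureOf {ℓ} (k : Subfield ℓ) : Set (c ⊔ ℓ₁ ⊔ ℓ₂ ⊔ ℓ) where
    field
      algebraicallyClosed : AlgebraicallyClosed
      algebraic           : ∀ x → Algebraic k x

  module Carlitz (T : Carrier) where

    C[T] : ℕ → Carrier → Carrier
    C[T] Q u = T * u + u ^ Q

    C : ℕ → Poly → Carrier → Carrier
    C Q N u = sum (λ (i : Fin (length N)) → lookup N i * iterate (C[T] Q) u (toℕ i))

    Torsion : ℕ → Poly → Pred Carrier ℓ₁
    Torsion Q N u = C Q N u ≈ 0#

    -- Meaningful only when 𝔽 has order Q.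
    cyclotomic : ∀ {ℓ} → (Q : ℕ) → (𝔽 : Subfield ℓ) → Poly → Subfield (c ⊔ ℓ₁ ⊔ ℓ)
    cyclotomic Q 𝔽 N = adjoin (𝔽 ⟨ T ⟩) (Torsion Q N)

{-# OPTIONS --safe #-}

-- Let Q = q^d, let 𝔽 be the field with Q elements, let S be the shift on
-- sequences in Ω and σ_m the coordinatewise m-th power.  On W = ker M(S) we look
-- for a polynomial G in S with coefficients in Ω such that twisting the
-- coefficients by Q amounts to multiplication by S − T.  Since M splits over 𝔽,
-- G can be built one root at a time, with nonzero value at every root, so that G
-- is invertible on W.  If s ∈ W has entries in 𝔽, then w = G s satisfies
-- w (n + 1) = T w n + (w n)^Q, so its entries are M-torsion points for C_Q.
--
-- Put H = ∏_{i<d} G^(q^i), the exponent denoting the twist.  If u is an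
-- M-torsion point for C_q, the sequence s n = C_q(T)ⁿ(u) lies in W and
-- σ_Q s = ∏_{i<d} (S − T^(q^i)) s, which is also how the twist by Q acts on H.
-- Hence v = H⁻¹ s is fixed by σ_Q, that is, v has entries in 𝔽, and s = H v has
-- entries in K_{Q,M}.
module Submission where

open import Defs
open import Algebra.Apartness.Bundles using (HeytingField; HeytingCommutativeRing)
import Algebra.Apartness.Properties.HeytingCommutativeRing as HeytingProperties
open import Algebra.Bundles using (CommutativeRing; CommutativeSemiring; RawRing)
import Algebra.Properties.AbelianGroup as AbelianGroupProperties
import Algebra.Properties.CommutativeMonoid.Sum as MonoidSum
import Algebra.Properties.CommutativeSemiring.Binomial as Binomial
import Algebra.Properties.CommutativeSemiring.Exp as CommutativeExp
import Algebra.Properties.Group as GroupProperties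
import Algebra.Properties.Ring as RingProperties
import Algebra.Properties.Semiring.Mult as Mult
import Algebra.Properties.Semiring.Sum as Sum
import Algebra.Solver.Ring as RingSolver
open import Algebra.Solver.Ring.AlmostCommutativeRing using (fromCommutativeRing; _-Raw-AlmostCommutative⟶_)
import Algebra.Solver.Ring.NaturalCoefficients.Default as NaturalSolver
open import Data.Empty using (⊥-elim)
open import Data.Fin.Base using (Fin; zero; suc; toℕ; fromℕ; inject₁; punchIn)
open import Data.Fin.Permutation using (Permutation; permutation; _⟨$⟩ʳ_)
open import Data.Fin.Properties using (any?; punchInᵢ≢i; toℕ-inject₁; toℕ-fromℕ; toℕ<n)
open import Data.List.Base using (List; []; _∷_; _++_; replicate; length; lookup; map; foldr)
open import Data.List.Relation.Unary.All as All using (All; []; _∷_)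
open import Data.Maybe.Base using (Maybe; just; nothing)
open import Data.Nat using (ℕ; _≤_)
open import Data.Nat.Base as ℕ using (zero; suc; z≤n; s≤s)
open import Data.Nat.Combinatorics using (_C_; nCn≡1; nC1≡n; nCk+nC[k+1]≡[n+1]C[k+1]; k>n⇒nCk≡0)
open import Data.Nat.Divisibility using (_∣_; divides; ∣⇒≤)
open import Data.Nat.GeneralisedArithmetic using (iterate)
open import Data.Nat.Primality using (Prime; prime; euclidsLemma; prime⇒nonTrivial)
import Data.Nat.Properties as ℕₚ
open import Data.Product.Base using (_×_; _,_; proj₁; proj₂; ∃-syntax)
open import Data.Product.Properties using (≡-dec)
open import Data.Sum.Base using (_⊎_; inj₁; inj₂)
open import Data.Unit.Polymorphic.Base using (⊤; tt)
open import Data.Vec.Base as Vec using (Vec; []; _∷_)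
open import Function.Bundles using (Bijection)
open import Level using (Level; _⊔_)
open import Relation.Binary.Definitions using (Decidable)
open import Relation.Binary.PropositionalEquality as ≡ using (_≡_; _≢_)
import Relation.Binary.Reasoning.Setoid as SetoidReasoning
open import Relation.Nullary using (¬_; yes; no)
open import Relation.Unary using (Pred; _∈_; _⊆_)

-- The equation for G is that of the Anderson-Thakur function, with the shift S in place of the
-- variable and read modulo M. At a root α in 𝔽 it becomes G(α)^Q = (α - T) G(α), which has a
-- nonzero solution because T is not in 𝔽. Values at the roots would determine G modulo M only for
-- simple roots; sequences and operators also carry the higher-order data at repeated ones.
--
-- Two obstacles shape the argument. The identities for G hold on W only, and twisting them is
-- legitimate because M has coefficients in 𝔽_q: W is then stable under σ_(q^i) and under entrywise
-- q^i-th roots. Moreover, G is controlled on sequences over 𝔽, whereas after one factor of H the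
-- entries are merely known to lie in K_{Q,M}. Since M splits over 𝔽, sequences over 𝔽 span W, and
-- linearity carries the control over to sequences in W with entries in K_{Q,M}.

-- Ring solver with integer coefficients.

-- The integer a − b is represented by the pair (a , b).
module IntegerSolver {c ℓ : Level} (R : CommutativeRing c ℓ) where

  open CommutativeRing R
  open Mult semiring using (×-homo-+; ×1-homo-*) renaming (_×_ to _·_)
  open RingProperties ring using (-‿distribˡ-*; -‿distribʳ-*; -0#≈0#; -‿involutive)
  open AbelianGroupProperties +-abelianGroup using (⁻¹-∙-comm)
  open NaturalSolver commutativeSemiring using (solve; _:+_; _:*_; _:=_)
  open SetoidReasoning setoid

  private
    -- Coefficients are kept with one entry zero, so that `_≡_` recognises equal integers; negation
    -- swaps the entries and preserves this form.
    cancel : ℕ × ℕ → ℕ × ℕ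
    cancel (suc a , suc b) = cancel (a , b)
    cancel (0     , b)     = 0 , b
    cancel (a     , 0)     = a , 0

    differences : RawRing _ _
    differences = record
      { Carrier = ℕ × ℕ
      ; _≈_     = _≡_
      ; _+_     = λ { (a , b) (x , y) → cancel (a ℕ.+ x , b ℕ.+ y) }
      ; _*_     = λ { (a , b) (x , y) → cancel (a ℕ.* x ℕ.+ b ℕ.* y , a ℕ.* y ℕ.+ b ℕ.* x) }
      ; -_      = λ { (a , b) → b , a }
      ; 0#      = 0 , 0
      ; 1#      = 1 , 0
      }

    module D = RawRing differences

    val : ℕ × ℕ → Carrier
    val (a , b) = a · 1# - b · 1#

    -- ⟦ (1 , 0) ⟧ has to be 1# on the nose for goals that mention 1#.
    ⟦_⟧ : ℕ × ℕ → Carrier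
    ⟦ 0 , 0 ⟧ = 0#
    ⟦ 1 , 0 ⟧ = 1#
    ⟦ n     ⟧ = val n

    ⟦_⟧≈val : ∀ n → ⟦ n ⟧ ≈ val n
    ⟦ 0 , 0           ⟧≈val = sym (trans (+-identityˡ _) -0#≈0#)
    ⟦ 1 , 0           ⟧≈val = sym (trans (+-cong (+-identityʳ 1#) -0#≈0#) (+-identityʳ 1#))
    ⟦ suc (suc a) , 0 ⟧≈val = refl
    ⟦ 0 , suc b       ⟧≈val = refl
    ⟦ 1 , suc b       ⟧≈val = refl
    ⟦ suc (suc a) , suc b ⟧≈val = refl

    +-interchange-neg : ∀ a b x y → (a + x) - (b + y) ≈ (a - b) + (x - y)
    +-interchange-neg a b x y = begin
      (a + x) - (b + y)       ≈⟨ +-congˡ (⁻¹-∙-comm b y) ⟨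
      (a + x) + (- b + - y)   ≈⟨ solve 4 (λ a x b y → (a :+ x) :+ (b :+ y) := (a :+ b) :+ (x :+ y)) refl a x (- b) (- y) ⟩
      (a - b) + (x - y)       ∎

    neg*neg : ∀ x y → - x * - y ≈ x * y
    neg*neg x y = begin
      - x * - y     ≈⟨ -‿distribˡ-* x (- y) ⟨
      - (x * - y)   ≈⟨ -‿cong (sym (-‿distribʳ-* x y)) ⟩
      - - (x * y)   ≈⟨ -‿involutive (x * y) ⟩
      x * y         ∎

    val-cancel : ∀ n → val (cancel n) ≈ val n
    val-cancel (suc a , suc b) = begin
      val (cancel (a , b))                ≈⟨ val-cancel (a , b) ⟩
      a · 1# - b · 1#                     ≈⟨ +-identityˡ _ ⟨
      0# + (a · 1# - b · 1#)              ≈⟨ +-congʳ (-‿inverseʳ 1#) ⟨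
      (1# - 1#) + (a · 1# - b · 1#)       ≈⟨ +-interchange-neg 1# 1# (a · 1#) (b · 1#) ⟨
      (1# + a · 1#) - (1# + b · 1#)       ∎
    val-cancel (0     , 0)     = refl
    val-cancel (0     , suc b) = refl
    val-cancel (suc a , 0)     = refl

    val-+ : ∀ m n → val (m D.+ n) ≈ val m + val n
    val-+ (a , b) (x , y) = trans
      (val-cancel (a ℕ.+ x , b ℕ.+ y))
      (trans (+-cong (×-homo-+ 1# a x) (-‿cong (×-homo-+ 1# b y)))
      (+-interchange-neg _ _ _ _))

    val-* : ∀ m n → val (m D.* n) ≈ val m * val n
    val-* (a , b) (x , y) = begin
      val (cancel (a ℕ.* x ℕ.+ b ℕ.* y , a ℕ.* y ℕ.+ b ℕ.* x))
        ≈⟨ val-cancel (a ℕ.* x ℕ.+ b ℕ.* y , a ℕ.* y ℕ.+ b ℕ.* x) ⟩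
      (a ℕ.* x ℕ.+ b ℕ.* y) · 1# - (a ℕ.* y ℕ.+ b ℕ.* x) · 1#
        ≈⟨ +-cong (homo a x b y) (-‿cong (homo a y b x)) ⟩
      (a · 1# * x · 1# + b · 1# * y · 1#) - (a · 1# * y · 1# + b · 1# * x · 1#)
        ≈⟨ expand (a · 1#) (b · 1#) (x · 1#) (y · 1#) ⟨
      (a · 1# - b · 1#) * (x · 1# - y · 1#) ∎
      where
      homo : ∀ a x b y → (a ℕ.* x ℕ.+ b ℕ.* y) · 1# ≈ a · 1# * x · 1# + b · 1# * y · 1#
      homo a x b y = trans (×-homo-+ 1# (a ℕ.* x) (b ℕ.* y)) (+-cong (×1-homo-* a x) (×1-homo-* b y))

      expand : ∀ a b x y → (a - b) * (x - y) ≈ (a * x + b * y) - (a * y + b * x)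
      expand a b x y = begin
        (a - b) * (x - y)
          ≈⟨ solve 4 (λ a b x y → (a :+ b) :* (x :+ y) := (a :* x :+ b :* y) :+ (a :* y :+ b :* x)) refl a (- b) x (- y) ⟩
        (a * x + - b * - y) + (a * - y + - b * x)
          ≈⟨ +-cong (+-congˡ (neg*neg b y)) (+-cong (sym (-‿distribʳ-* a y)) (sym (-‿distribˡ-* b x))) ⟩
        (a * x + b * y) + (- (a * y) - b * x)
          ≈⟨ +-congˡ (⁻¹-∙-comm _ _) ⟩
        (a * x + b * y) - (a * y + b * x) ∎

    val-neg : ∀ n → val (D.- n) ≈ - val n
    val-neg (a , b) = begin
      b · 1# - a · 1#           ≈⟨ +-comm _ _ ⟩
      - (a · 1#) + b · 1#       ≈⟨ +-congˡ (-‿involutive _) ⟨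
      - (a · 1#) - - (b · 1#)   ≈⟨ ⁻¹-∙-comm _ _ ⟩
      - (a · 1# - b · 1#)       ∎

    morphism : differences -Raw-AlmostCommutative⟶ fromCommutativeRing R
    morphism = record
      { ⟦_⟧    = ⟦_⟧
      ; +-homo = λ m n → trans ⟦ m D.+ n ⟧≈val (trans (val-+ m n) (sym (+-cong ⟦ m ⟧≈val ⟦ n ⟧≈val)))
      ; *-homo = λ m n → trans ⟦ m D.* n ⟧≈val (trans (val-* m n) (sym (*-cong ⟦ m ⟧≈val ⟦ n ⟧≈val)))
      ; -‿homo = λ n → trans ⟦ D.- n ⟧≈val (trans (val-neg n) (sym (-‿cong ⟦ n ⟧≈val)))
      ; 0-homo = refl
      ; 1-homo = refl
      }

    ⟦⟧≟ : ∀ m n → Maybe (⟦ m ⟧ ≈ ⟦ n ⟧)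
    ⟦⟧≟ m n with ≡-dec ℕₚ._≟_ ℕₚ._≟_ m n
    ... | no  _      = nothing
    ... | yes ≡.refl = just refl

  open RingSolver differences (fromCommutativeRing R) morphism ⟦⟧≟ public

  :0 :1 : ∀ {n} → Polynomial n
  :0 = con (0 , 0)
  :1 = con (1 , 0)

-- Binomial coefficients and additivity of p-th powers.

-- Absorption identity, by induction with Pascal's rule. For n + 1 = p it exhibits a multiple of p
-- to which Euclid's lemma applies.
[1+k]*[1+n]C[1+k]≡[1+n]*nCk : ∀ n k → suc k ℕ.* (suc n C suc k) ≡ suc n ℕ.* (n C k)
[1+k]*[1+n]C[1+k]≡[1+n]*nCk zero zero = ≡.refl
[1+k]*[1+n]C[1+k]≡[1+n]*nCk zero (suc k) = ≡.trans
  (≡.cong (suc (suc k) ℕ.*_) (k>n⇒nCk≡0 {1} {suc (suc k)} (s≤s (s≤s z≤n))))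
  (≡.trans (ℕₚ.*-zeroʳ (suc (suc k))) (≡.sym (≡.cong (1 ℕ.*_) (k>n⇒nCk≡0 {0} {suc k} (s≤s z≤n)))))
[1+k]*[1+n]C[1+k]≡[1+n]*nCk (suc n) zero = ≡.trans (ℕₚ.*-identityˡ _) (≡.trans (nC1≡n (suc (suc n))) (≡.sym (ℕₚ.*-identityʳ _)))
[1+k]*[1+n]C[1+k]≡[1+n]*nCk (suc n) (suc k) = begin
  suc (suc k) ℕ.* (suc (suc n) C suc (suc k))
    ≡⟨ ≡.cong (suc (suc k) ℕ.*_) (nCk+nC[k+1]≡[n+1]C[k+1] (suc n) (suc k)) ⟨
  suc (suc k) ℕ.* (A ℕ.+ (suc n C suc (suc k)))
    ≡⟨ ℕₚ.*-distribˡ-+ (suc (suc k)) A _ ⟩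
  (A ℕ.+ suc k ℕ.* A) ℕ.+ suc (suc k) ℕ.* (suc n C suc (suc k))
    ≡⟨ ≡.cong₂ (λ x y → (A ℕ.+ x) ℕ.+ y) ([1+k]*[1+n]C[1+k]≡[1+n]*nCk n k) ([1+k]*[1+n]C[1+k]≡[1+n]*nCk n (suc k)) ⟩
  (A ℕ.+ suc n ℕ.* (n C k)) ℕ.+ suc n ℕ.* (n C suc k)
    ≡⟨ ℕₚ.+-assoc A _ _ ⟩
  A ℕ.+ (suc n ℕ.* (n C k) ℕ.+ suc n ℕ.* (n C suc k))
    ≡⟨ ≡.cong (A ℕ.+_) (ℕₚ.*-distribˡ-+ (suc n) (n C k) (n C suc k)) ⟨
  A ℕ.+ suc n ℕ.* ((n C k) ℕ.+ (n C suc k))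
    ≡⟨ ≡.cong (λ x → A ℕ.+ suc n ℕ.* x) (nCk+nC[k+1]≡[n+1]C[k+1] n k) ⟩
  A ℕ.+ suc n ℕ.* A ∎
  where
  open ≡.≡-Reasoning
  A = suc n C suc k

prime∣pCk : ∀ {p k} → Prime p → 0 ℕ.< k → k ℕ.< p → p ∣ p C k
prime∣pCk {suc n} {suc k} pp _ k<p
  with euclidsLemma (suc k) (suc n C suc k) pp
         (divides (n C k) (≡.trans ([1+k]*[1+n]C[1+k]≡[1+n]*nCk n k) (ℕₚ.*-comm (suc n) (n C k))))
... | inj₁ p∣k = ⊥-elim (ℕₚ.<⇒≱ k<p (∣⇒≤ p∣k))
... | inj₂ p∣C = p∣C

module Frobenius {c ℓ : Level} (R : CommutativeSemiring c ℓ) where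

  open CommutativeSemiring R hiding (zero)
  open CommutativeExp R
  open Mult semiring using (×-assocˡ; ×-homo-1; ×-congˡ; ×-congʳ; ×-assoc-*) renaming (_×_ to _·_)
  open Sum semiring
  open SetoidReasoning setoid

  private
    kills : ∀ {p} → p · 1# ≈ 0# → ∀ {n} → p ∣ n → ∀ x → n · x ≈ 0#
    kills {p} char {n} (divides m eq) x = begin
      n · x                ≈⟨ ×-congˡ eq ⟩
      (m ℕ.* p) · x        ≈⟨ ×-congˡ (ℕₚ.*-comm m p) ⟩
      (p ℕ.* m) · x        ≈⟨ ×-assocˡ x p m ⟨
      p · (m · x)          ≈⟨ ×-congʳ p (*-identityˡ _) ⟨
      p · (1# * m · x)     ≈⟨ ×-assoc-* p 1# _ ⟨
      (p · 1#) * (m · x)   ≈⟨ *-congʳ char ⟩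
      0# * (m · x)         ≈⟨ zeroˡ _ ⟩
      0#                   ∎

  ^p-distrib-+ : ∀ {p} → Prime p → p · 1# ≈ 0# → ∀ x y → (x + y) ^ p ≈ x ^ p + y ^ p
  ^p-distrib-+ {0} (prime {{()}} _)
  ^p-distrib-+ {1} (prime {{()}} _)
  ^p-distrib-+ {p@(suc (suc n))} pp char x y = begin
    (x + y) ^ p                              ≈⟨ Binomial.theorem R p x y ⟩
    term zero + sum (λ i → term (suc i))     ≈⟨ +-congˡ (sum-init-last (λ i → term (suc i))) ⟩
    term zero + (sum (λ i → term (suc (inject₁ i))) + term (suc (fromℕ (suc n))))
      ≈⟨ +-congˡ (+-congʳ (trans (sum-cong-≋ middle≈0) (sum-replicate-zero (suc n)))) ⟩
    term zero + (0# + term (suc (fromℕ (suc n))))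
      ≈⟨ +-cong first (trans (+-identityˡ _) last-term) ⟩
    y ^ p + x ^ p                            ≈⟨ +-comm _ _ ⟩
    x ^ p + y ^ p                            ∎
    where
    term : Fin (suc p) → Carrier
    term = Binomial.binomialTerm R x y p

    first : term zero ≈ y ^ p
    first = trans (×-homo-1 _) (*-identityˡ _)

    last-term : term (suc (fromℕ (suc n))) ≈ x ^ p
    last-term = top (≡.cong suc (toℕ-fromℕ (suc n)))
      where
      top : ∀ {k} → k ≡ p → (p C k) · (x ^ k * y ^ (p ℕ.∸ k)) ≈ x ^ p
      top ≡.refl = begin
        (p C p) · (x ^ p * y ^ (p ℕ.∸ p))   ≈⟨ ×-congˡ (nCn≡1 p) ⟩
        1 · (x ^ p * y ^ (p ℕ.∸ p))         ≈⟨ ×-homo-1 _ ⟩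
        x ^ p * y ^ (p ℕ.∸ p)               ≈⟨ *-congˡ (^-congʳ y (ℕₚ.n∸n≡0 p)) ⟩
        x ^ p * 1#                          ≈⟨ *-identityʳ _ ⟩
        x ^ p                               ∎

    middle≈0 : ∀ i → term (suc (inject₁ i)) ≈ 0#
    middle≈0 i = kills char (prime∣pCk pp (s≤s z≤n) (s≤s bound)) _
      where
      bound : toℕ (inject₁ i) ℕ.< suc n
      bound rewrite toℕ-inject₁ i = toℕ<n i

  -- The operator arguments see the characteristic only through this property, which passes from p
  -- to all its powers.
  AdditivePower : ℕ → Set _
  AdditivePower n = ∀ x y → (x + y) ^ n ≈ x ^ n + y ^ n

  additivePower-1 : AdditivePower 1
  additivePower-1 x y = trans (*-identityʳ _) (sym (+-cong (*-identityʳ x) (*-identityʳ y)))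

  additivePower-* : ∀ {m n} → AdditivePower m → AdditivePower n → AdditivePower (m ℕ.* n)
  additivePower-* {m} {n} addᵐ addⁿ x y = begin
    (x + y) ^ (m ℕ.* n)              ≈⟨ ^-assocʳ (x + y) m n ⟨
    ((x + y) ^ m) ^ n                ≈⟨ ^-congˡ n (addᵐ x y) ⟩
    (x ^ m + y ^ m) ^ n              ≈⟨ addⁿ (x ^ m) (y ^ m) ⟩
    (x ^ m) ^ n + (y ^ m) ^ n        ≈⟨ +-cong (^-assocʳ x m n) (^-assocʳ y m n) ⟩
    x ^ (m ℕ.* n) + y ^ (m ℕ.* n)    ∎

  additivePower-^ : ∀ {m} → AdditivePower m → ∀ i → AdditivePower (m ℕ.^ i)
  additivePower-^ add zero    = additivePower-1
  additivePower-^ {m} add (suc i) = additivePower-* {m} add (additivePower-^ add i)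

-- Fields with decidable apartness and roots of polynomials.

module FieldProperties {c ℓ₁ ℓ₂ : Level} (Ω : HeytingField c ℓ₁ ℓ₂)
                       (_#?_ : Decidable (HeytingField._#_ Ω)) where

  open HeytingField Ω hiding (zero)
  open HeytingCommutativeRing heytingCommutativeRing using (commutativeRing)
  open CommutativeRing commutativeRing using (semiring; commutativeSemiring; *-commutativeMonoid; +-group)
  open HeytingProperties heytingCommutativeRing using (x-0≈x; 1#0; x#0y#0→xy#0; #-congʳ)
  open CommutativeExp commutativeSemiring using (_^_)
  open GroupProperties +-group using (x∙y⁻¹≈ε⇒x≈y; identityʳ-unique)
  open IntegerSolver commutativeRing using (solve; _:+_; _:*_; :-_; _:-_; _:=_; :0; :1)
  open FieldTheory Ω
  open SetoidReasoning setoid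

  #⇒≉ : ∀ {x y} → x # y → ¬ x ≈ y
  #⇒≉ {x} {y} x#y x≈y = proj₂ (tight x y) x≈y x#y

  ≈⊎# : ∀ x y → x ≈ y ⊎ x # y
  ≈⊎# x y with x #? y
  ... | yes x#y = inj₂ x#y
  ... | no ¬x#y = inj₁ (proj₁ (tight x y) ¬x#y)

  _≈?_ : Decidable _≈_
  x ≈? y with ≈⊎# x y
  ... | inj₁ x≈y = yes x≈y
  ... | inj₂ x#y = no (#⇒≉ x#y)

  ≉⇒# : ∀ {x y} → ¬ x ≈ y → x # y
  ≉⇒# {x} {y} x≉y with ≈⊎# x y
  ... | inj₁ x≈y = ⊥-elim (x≉y x≈y)
  ... | inj₂ x#y = x#y

  1≉0 : ¬ 1# ≈ 0#
  1≉0 = #⇒≉ 1#0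

  inverse : ∀ {x} → x # 0# → ∃[ y ] x * y ≈ 1#
  inverse {x} x#0 with #⇒invertible x#0
  ... | y , _ , eq = y , trans (*-congʳ (sym (x-0≈x x))) eq

  xy≈0⇒y≈0 : ∀ {x y} → x # 0# → x * y ≈ 0# → y ≈ 0#
  xy≈0⇒y≈0 {x} {y} x#0 xy≈0 with inverse x#0
  ... | z , xz≈1 = begin
    y              ≈⟨ *-identityˡ y ⟨
    1# * y         ≈⟨ *-congʳ xz≈1 ⟨
    (x * z) * y    ≈⟨ solve 3 (λ x z y → (x :* z) :* y := z :* (x :* y)) refl x z y ⟩
    z * (x * y)    ≈⟨ *-congˡ xy≈0 ⟩
    z * 0#         ≈⟨ zeroʳ z ⟩
    0#             ∎

  x^n≈0⇒x≈0 : ∀ {x} n → x ^ n ≈ 0# → x ≈ 0#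
  x^n≈0⇒x≈0 zero    1≈0 = ⊥-elim (1≉0 1≈0)
  x^n≈0⇒x≈0 {x} (suc n) eq with ≈⊎# x 0#
  ... | inj₁ x≈0 = x≈0
  ... | inj₂ x#0 = x^n≈0⇒x≈0 n (xy≈0⇒y≈0 x#0 eq)

  -- The leading coefficient 1 is implicit.
  monic : ∀ {n} → Vec Carrier n → Carrier → Carrier
  monic []       x = 1#
  monic (a ∷ as) x = a + x * monic as x

  -- Synthetic division by X - β: Horner's scheme produces the coefficients of the quotient as
  -- values of the tails at β.
  quotient : ∀ {n} → Vec Carrier (suc n) → Carrier → Vec Carrier n
  quotient (a ∷ [])     β = []
  quotient (a ∷ b ∷ as) β = monic (b ∷ as) β ∷ quotient (b ∷ as) β

  monic-quotient : ∀ {n} (as : Vec Carrier (suc n)) β x →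
    monic as x ≈ monic as β + (x - β) * monic (quotient as β) x
  monic-quotient (a ∷ []) β x =
    solve 3 (λ a β x → a :+ x :* :1 := (a :+ β :* :1) :+ (x :- β) :* :1) refl a β x
  monic-quotient (a ∷ b ∷ as) β x = begin
    a + x * monic (b ∷ as) x
      ≈⟨ +-congˡ (*-congˡ (monic-quotient (b ∷ as) β x)) ⟩
    a + x * (m + (x - β) * r)
      ≈⟨ solve 5 (λ a β x m r → a :+ x :* (m :+ (x :- β) :* r) := (a :+ β :* m) :+ (x :- β) :* (m :+ x :* r)) refl a β x m r ⟩
    (a + β * m) + (x - β) * (m + x * r) ∎
    where
    m = monic (b ∷ as) β
    r = monic (quotient (b ∷ as) β) x

  -- Dividing by X - β₀ keeps x and the remaining β as roots of the quotient; after n divisions the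
  -- quotient is 1, which has no root.
  monic-roots : ∀ {n} (as : Vec Carrier n) (β : Fin n → Carrier) →
    (∀ {i j} → i ≢ j → β i # β j) → (∀ i → monic as (β i) ≈ 0#) →
    ∀ x → (∀ i → x # β i) → ¬ monic as x ≈ 0#
  monic-roots []          β distinct roots x x#β x-root = 1≉0 x-root
  monic-roots {suc n} as β distinct roots x x#β x-root =
    monic-roots (quotient as β₀) (λ i → β (suc i)) (λ i≢j → distinct λ { ≡.refl → i≢j ≡.refl })
      (λ i → quotient-root (distinct λ ()) (roots (suc i))) x (λ i → x#β (suc i))
      (quotient-root (x#β zero) x-root)
    where
    β₀ = β zero
    quotient-root : ∀ {y} → y # β₀ → monic as y ≈ 0# → monic (quotient as β₀) y ≈ 0#
    quotient-root {y} y#β₀ y-root = xy≈0⇒y≈0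
      (≉⇒# λ eq → #⇒≉ y#β₀ (x∙y⁻¹≈ε⇒x≈y y β₀ eq))
      (begin
        (y - β₀) * monic (quotient as β₀) y                   ≈⟨ +-identityˡ _ ⟨
        0# + (y - β₀) * monic (quotient as β₀) y              ≈⟨ +-congʳ (roots zero) ⟨
        monic as β₀ + (y - β₀) * monic (quotient as β₀) y     ≈⟨ monic-quotient as β₀ y ⟨
        monic as y                                            ≈⟨ y-root ⟩
        0#                                                    ∎)

  X^[2+n]-X : ∀ n → Vec Carrier (suc (suc n))
  X^[2+n]-X n = 0# ∷ - 1# ∷ Vec.replicate n 0#

  monic-X^n : ∀ n x → monic (Vec.replicate n 0#) x ≈ x ^ n
  monic-X^n zero    x = refl
  monic-X^n (suc n) x = trans (+-identityˡ _) (*-congˡ (monic-X^n n x))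

  monic-X^[2+n]-X : ∀ n x → monic (X^[2+n]-X n) x ≈ x ^ suc (suc n) - x
  monic-X^[2+n]-X n x = trans
    (+-congˡ (*-congˡ (+-congˡ (*-congˡ (monic-X^n n x)))))
    (solve 2 (λ x xⁿ → :0 :+ x :* (:- :1 :+ x :* xⁿ) := x :* (x :* xⁿ) :- x) refl x (x ^ n))

  x≈y⇒x-y≈0 : ∀ {x y} → x ≈ y → x - y ≈ 0#
  x≈y⇒x-y≈0 x≈y = trans (+-congʳ x≈y) (-‿inverseʳ _)

  -- Finite subfields as fixed points of a power map.

  module FiniteField {ℓ} (k : Subfield ℓ) {n : ℕ} (order : HasOrder k n) where

    open Subfield k using (0-closed; 1-closed; +-closed; neg-closed; *-closed; inv-closed; respects)

    element : Fin n → Carrier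
    element i = proj₁ (Bijection.to order i)

    element∈k : ∀ i → element i ∈ ⟦ k ⟧
    element∈k i = proj₂ (Bijection.to order i)

    element-injective : ∀ {i j} → element i ≈ element j → i ≡ j
    element-injective = Bijection.injective order

    index : ∀ {x} → x ∈ ⟦ k ⟧ → Fin n
    index {x} x∈k = proj₁ (Bijection.surjective order (x , x∈k))

    element-index : ∀ {x} (x∈k : x ∈ ⟦ k ⟧) → element (index x∈k) ≈ x
    element-index {x} x∈k = proj₂ (Bijection.surjective order (x , x∈k)) ≡.refl

    module _ {f g : Carrier → Carrier}
             (f-cong : ∀ {x y} → x ≈ y → f x ≈ f y) (g-cong : ∀ {x y} → x ≈ y → g x ≈ g y)
             (f-closed : ∀ {x} → x ∈ ⟦ k ⟧ → f x ∈ ⟦ k ⟧) (g-closed : ∀ {x} → x ∈ ⟦ k ⟧ → g x ∈ ⟦ k ⟧)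
             (f∘g : ∀ x → f (g x) ≈ x) (g∘f : ∀ x → g (f x) ≈ x) where

      permute : Permutation n n
      permute = permutation
        (λ i → index (f-closed (element∈k i)))
        (λ i → index (g-closed (element∈k i)))
        (λ i → element-injective (trans (element-index _) (trans (f-cong (element-index _)) (f∘g _))))
        (λ i → element-injective (trans (element-index _) (trans (g-cong (element-index _)) (g∘f _))))

      element-permute : ∀ i → element (permute ⟨$⟩ʳ i) ≈ f (element i)
      element-permute i = element-index _

    -- Translation by 1 permutes k, so adding 1 to every element does not
    -- change the sum of all elements.
    n·1≈0 : Mult._×_ semiring n 1# ≈ 0#
    n·1≈0 = identityʳ-unique (sum element) _ (begin
      sum element + Mult._×_ semiring n 1#       ≈⟨ +-congˡ (sum-replicate n) ⟨
      sum element + sum {n} (λ _ → 1#)           ≈⟨ ∑-distrib-+ element (λ _ → 1#) ⟨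
      sum (λ i → element i + 1#)                 ≈⟨ sum-cong-≋ (element-permute +1-cong -1-cong +1-closed -1-closed +1∘-1 -1∘+1) ⟨
      sum (λ i → element (π ⟨$⟩ʳ i))             ≈⟨ sum-permute element π ⟨
      sum element                                ∎)
      where
      open Sum semiring
      +1-cong : ∀ {x y} → x ≈ y → x + 1# ≈ y + 1#
      +1-cong = +-congʳ
      -1-cong : ∀ {x y} → x ≈ y → x - 1# ≈ y - 1#
      -1-cong = +-congʳ
      +1-closed : ∀ {x} → x ∈ ⟦ k ⟧ → x + 1# ∈ ⟦ k ⟧
      +1-closed x∈k = +-closed x∈k 1-closed
      -1-closed : ∀ {x} → x ∈ ⟦ k ⟧ → x - 1# ∈ ⟦ k ⟧
      -1-closed x∈k = +-closed x∈k (neg-closed 1-closed)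
      +1∘-1 : ∀ x → (x - 1#) + 1# ≈ x
      +1∘-1 = solve 1 (λ x → (x :- :1) :+ :1 := x) refl
      -1∘+1 : ∀ x → (x + 1#) - 1# ≈ x
      -1∘+1 = solve 1 (λ x → (x :+ :1) :- :1 := x) refl
      π = permute +1-cong -1-cong +1-closed -1-closed +1∘-1 -1∘+1

    private
      -- Lets products over the nonzero elements run over all of `Fin n`, the zero element
      -- contributing the factor 1.
      ifNonzero : Carrier → Carrier → Carrier
      ifNonzero x y with ≈⊎# y 0#
      ... | inj₁ _ = 1#
      ... | inj₂ _ = x

      ifNonzero-# : ∀ {x y} → y # 0# → ifNonzero x y ≈ x
      ifNonzero-# {x} {y} y#0 with ≈⊎# y 0#
      ... | inj₁ y≈0 = ⊥-elim (#⇒≉ y#0 y≈0)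
      ... | inj₂ _   = refl

      ifNonzero-0 : ∀ {x y} → y ≈ 0# → ifNonzero x y ≈ 1#
      ifNonzero-0 {x} {y} y≈0 with ≈⊎# y 0#
      ... | inj₁ _   = refl
      ... | inj₂ y#0 = ⊥-elim (#⇒≉ y#0 y≈0)

      module Π = MonoidSum *-commutativeMonoid

      Π#0 : ∀ {m} (f : Fin m → Carrier) → (∀ i → f i # 0#) → Π.sum f # 0#
      Π#0 {zero}  f f#0 = 1#0
      Π#0 {suc m} f f#0 = x#0y#0→xy#0 (f#0 zero) (Π#0 (λ i → f (suc i)) (λ i → f#0 (suc i)))

    -- Multiplication by x permutes k, so the product of the nonzero elements
    -- is unchanged when each of them is multiplied by x.
    Π-ifNonzero≈1 : ∀ {x} → x ∈ ⟦ k ⟧ → x # 0# → Π.sum (λ i → ifNonzero x (element i)) ≈ 1#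
    Π-ifNonzero≈1 {x} x∈k x#0 with inverse x#0
    ... | z , xz≈1 = x∙y⁻¹≈ε⇒x≈y _ _ (xy≈0⇒y≈0 (Π#0 units units#0) (begin
      U * (X - 1#)     ≈⟨ solve 2 (λ u x → u :* (x :- :1) := x :* u :- u) refl U X ⟩
      X * U - U        ≈⟨ x≈y⇒x-y≈0 X*U≈U ⟩
      0#               ∎))
      where
      units = λ i → ifNonzero (element i) (element i)
      U = Π.sum units
      X = Π.sum (λ i → ifNonzero x (element i))

      units#0 : ∀ i → units i # 0#
      units#0 i with ≈⊎# (element i) 0#
      ... | inj₁ _  = 1#0
      ... | inj₂ #0 = #0

      x∘z : ∀ y → x * (z * y) ≈ y
      x∘z y = trans (sym (*-assoc x z y)) (trans (*-congʳ xz≈1) (*-identityˡ y))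

      z∘x : ∀ y → z * (x * y) ≈ y
      z∘x y = trans (solve 3 (λ x y z → z :* (x :* y) := x :* (z :* y)) refl x y z) (x∘z y)

      z∈k : z ∈ ⟦ k ⟧
      z∈k = inv-closed x∈k xz≈1

      π = permute {x *_} {z *_} *-congˡ *-congˡ (*-closed x∈k) (*-closed z∈k) x∘z z∘x

      element-π : ∀ i → element (π ⟨$⟩ʳ i) ≈ x * element i
      element-π = element-permute {x *_} {z *_} *-congˡ *-congˡ (*-closed x∈k) (*-closed z∈k) x∘z z∘x

      units-π : ∀ i → units (π ⟨$⟩ʳ i) ≈ ifNonzero x (element i) * units i
      units-π i with ≈⊎# (element i) 0#
      ... | inj₁ ≈0 = trans
        (ifNonzero-0 (trans (element-π i) (trans (*-congˡ ≈0) (zeroʳ x))))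
        (sym (*-identityˡ 1#))
      ... | inj₂ #0 = trans
        (ifNonzero-# (#-congʳ (sym (element-π i)) (x#0y#0→xy#0 x#0 #0)))
        (element-π i)

      X*U≈U : X * U ≈ U
      X*U≈U = begin
        X * U                                            ≈⟨ Π.∑-distrib-+ (λ i → ifNonzero x (element i)) units ⟨
        Π.sum (λ i → ifNonzero x (element i) * units i)  ≈⟨ Π.sum-cong-≋ units-π ⟨
        Π.sum (λ i → units (π ⟨$⟩ʳ i))                   ≈⟨ Π.sum-permute units π ⟨
        U                                                ∎

    private
      -- Only the index `i₀` contributes 1 instead of x, so the product is x ^ m.
      x^[1+m]≈x : ∀ {m} (f : Fin (suc m) → Carrier) (i₀ : Fin (suc m)) → f i₀ ≈ 0# →
        (∀ i → i ≢ i₀ → f i # 0#) → ∀ {x} → Π.sum (λ i → ifNonzero x (f i)) ≈ 1# → x ^ suc m ≈ x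
      x^[1+m]≈x {m} f i₀ f₀≈0 f#0 {x} Π≈1 = trans (*-congˡ (begin
        x ^ m                                                   ≈⟨ Π.sum-replicate m ⟨
        Π.sum {m} (λ _ → x)                                     ≈⟨ Π.sum-cong-≋ (λ j → ifNonzero-# (f#0 _ (punchInᵢ≢i i₀ j))) ⟨
        Π.sum (λ j → ifNonzero x (f (punchIn i₀ j)))            ≈⟨ *-identityˡ _ ⟨
        1# * Π.sum (λ j → ifNonzero x (f (punchIn i₀ j)))       ≈⟨ *-congʳ (ifNonzero-0 f₀≈0) ⟨
        ifNonzero x (f i₀) * Π.sum (λ j → ifNonzero x (f (punchIn i₀ j)))
                                                                ≈⟨ Π.sum-remove {i = i₀} (λ i → ifNonzero x (f i)) ⟨
        Π.sum (λ i → ifNonzero x (f i))                         ≈⟨ Π≈1 ⟩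
        1#                                                      ∎)) (*-identityʳ x)

      -- The exponent is a copy of the module parameter n on which a case split is possible; zero is
      -- excluded because k contains 0.
      fermat : ∀ {m} → m ≡ n → ∀ {x} → x ∈ ⟦ k ⟧ → x ^ m ≈ x
      fermat {zero}  ≡.refl x∈k with () ← index 0-closed
      fermat {suc m} ≡.refl {x} x∈k with ≈⊎# x 0#
      ... | inj₁ x≈0 = trans (*-congʳ x≈0) (trans (zeroˡ _) (sym x≈0))
      ... | inj₂ x#0 = x^[1+m]≈x element (index 0-closed) (element-index 0-closed)
        (λ i i≢i₀ → ≉⇒# λ eᵢ≈0 → i≢i₀ (element-injective (trans eᵢ≈0 (sym (element-index 0-closed)))))
        (Π-ifNonzero≈1 x∈k x#0)

    x∈k⇒x^n≈x : ∀ {x} → x ∈ ⟦ k ⟧ → x ^ n ≈ x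
    x∈k⇒x^n≈x = fermat ≡.refl

    private
      -- The elements of k are already n distinct roots of X^n - X, which leaves no room for a
      -- further one.
      fixed⇒∈k : ∀ {m} → suc (suc m) ≡ n → ∀ {x} → x ^ n ≈ x → x ∈ ⟦ k ⟧
      fixed⇒∈k {m} ≡.refl {x} x^n≈x with any? (λ i → element i ≈? x)
      ... | yes (i , eᵢ≈x) = respects eᵢ≈x (element∈k i)
      ... | no  ∄i = ⊥-elim (monic-roots (X^[2+n]-X m) element
        (λ i≢j → ≉⇒# λ eq → i≢j (element-injective eq))
        (λ i → root (x∈k⇒x^n≈x (element∈k i)))
        x (λ i → ≉⇒# λ eq → ∄i (i , sym eq)) (root x^n≈x))
        where
        root : ∀ {y} → y ^ suc (suc m) ≈ y → monic (X^[2+n]-X m) y ≈ 0#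
        root fixed = trans (monic-X^[2+n]-X m _) (x≈y⇒x-y≈0 fixed)

    x^n≈x⇒x∈k : 2 ℕ.≤ n → ∀ {x} → x ^ n ≈ x → x ∈ ⟦ k ⟧
    x^n≈x⇒x∈k (ℕ.s≤s (ℕ.s≤s {n = m} _)) = fixed⇒∈k {m} ≡.refl

  -- Explicit polynomials over an algebraically closed field.

  eval-∷ : ∀ a f x → eval (a ∷ f) x ≈ a + x * eval f x
  eval-∷ a f x = +-cong (*-identityʳ a) (trans
    (sum-cong-≋ λ i → solve 3 (λ b x y → b :* (x :* y) := x :* (b :* y)) refl (lookup f i) x (x ^ toℕ i))
    (sym (*-distribˡ-sum x (λ i → lookup f i * x ^ toℕ i))))
    where open Sum semiring

  X^_ : ℕ → Poly
  X^ n = replicate n 0# ++ 1# ∷ []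

  eval-X^ : ∀ n x → eval (X^ n) x ≈ x ^ n
  eval-X^ zero    x = trans (eval-∷ 1# [] x) (trans (+-congˡ (zeroʳ x)) (+-identityʳ 1#))
  eval-X^ (suc n) x = trans (eval-∷ 0# (X^ n) x) (trans (+-identityˡ _) (*-congˡ (eval-X^ n x)))

  coeff-X^ : ∀ n → coeff (X^ n) n ≡ 1#
  coeff-X^ zero    = ≡.refl
  coeff-X^ (suc n) = coeff-X^ n

  X^∈k[X] : ∀ {ℓ} (k : Subfield ℓ) n → X^ n ∈ k [X]
  X^∈k[X] k zero    = Subfield.1-closed k ∷ []
  X^∈k[X] k (suc n) = Subfield.0-closed k ∷ X^∈k[X] k n

  eval-trinomial : ∀ a b n x → eval (a ∷ b ∷ X^ n) x ≈ a + (b * x + x ^ suc (suc n))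
  eval-trinomial a b n x = begin
    eval (a ∷ b ∷ X^ n) x             ≈⟨ trans (eval-∷ a (b ∷ X^ n) x) (+-congˡ (*-congˡ (eval-∷ b (X^ n) x))) ⟩
    a + x * (b + x * eval (X^ n) x)   ≈⟨ +-congˡ (*-congˡ (+-congˡ (*-congˡ (eval-X^ n x)))) ⟩
    a + x * (b + x * x ^ n)           ≈⟨ solve 4 (λ a b x y → a :+ x :* (b :+ x :* y) := a :+ (b :* x :+ x :* (x :* y))) refl a b x (x ^ n) ⟩
    a + (b * x + x * (x * x ^ n))     ∎

  1#0-coeff-X^ : ∀ n → coeff (X^ n) n # 0#
  1#0-coeff-X^ n rewrite coeff-X^ n = 1#0

  trinomial-root : AlgebraicallyClosed → ∀ {n} → 2 ℕ.≤ n → ∀ a b → ∃[ x ] a + (b * x + x ^ n) ≈ 0#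
  trinomial-root closed (ℕ.s≤s (ℕ.s≤s {n = n} _)) a b with closed (a ∷ b ∷ X^ n) (suc n , 1#0-coeff-X^ n)
  ... | x , root = x , trans (sym (eval-trinomial a b n x)) root

  nth-root : AlgebraicallyClosed → ∀ {n} → 1 ℕ.≤ n → ∀ a → ∃[ x ] x ^ n ≈ a
  nth-root closed (ℕ.s≤s {n = n} _) a with closed (- a ∷ X^ n) (n , 1#0-coeff-X^ n)
  ... | x , root = x , x∙y⁻¹≈ε⇒x≈y _ _ (begin
    x * x ^ n - a                ≈⟨ +-comm _ _ ⟩
    - a + x * x ^ n              ≈⟨ +-congˡ (*-congˡ (eval-X^ n x)) ⟨
    - a + x * eval (X^ n) x      ≈⟨ eval-∷ (- a) (X^ n) x ⟨
    eval (- a ∷ X^ n) x          ≈⟨ root ⟩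
    0#                           ∎)

  -- X^n - X has coefficients in every subfield and leading coefficient 1. This keeps T out of 𝔽_Q,
  -- hence apart from the roots of M.
  transcendental⇒x^n≉x : ∀ {ℓ} (k : Subfield ℓ) {t} → Transcendental k t → ∀ {n} → 2 ℕ.≤ n → ¬ t ^ n ≈ t
  transcendental⇒x^n≉x k {t} trans-t (ℕ.s≤s (ℕ.s≤s {n = n} _)) fixed =
    1≉0 (trans (sym (reflexive (coeff-X^ n)))
      (trans-t (0# ∷ - 1# ∷ X^ n) (0-closed ∷ neg-closed 1-closed ∷ X^∈k[X] k n) (begin
        eval (0# ∷ - 1# ∷ X^ n) t           ≈⟨ eval-trinomial 0# (- 1#) n t ⟩
        0# + (- 1# * t + t ^ suc (suc n))   ≈⟨ solve 2 (λ t y → :0 :+ (:- :1 :* t :+ y) := y :- t) refl t _ ⟩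
        t ^ suc (suc n) - t                 ≈⟨ x≈y⇒x-y≈0 fixed ⟩
        0#                                  ∎) (suc (suc n))))
    where open Subfield k

-- Polynomials in the shift and their Frobenius twists.

module Operators {c ℓ₁ ℓ₂ : Level} (Ω : HeytingField c ℓ₁ ℓ₂) where

  open HeytingField Ω hiding (zero)
  open HeytingCommutativeRing heytingCommutativeRing using (commutativeRing)
  open CommutativeRing commutativeRing using (semiring; commutativeSemiring; +-group)
  open CommutativeExp commutativeSemiring using (_^_; ^-congˡ; ^-distrib-*)
  open GroupProperties +-group using (identityʳ-unique; inverseʳ-unique)
  open Frobenius commutativeSemiring using (AdditivePower)
  open IntegerSolver commutativeRing using (solve; _:+_; _:*_; :-_; _:=_; :0; :1)
  open FieldTheory Ω

  infixl 6 _⊕_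
  infixl 7 _⊗_
  infix  4 _≋_

  Seq : Set c
  Seq = ℕ → Carrier

  _≋_ : Seq → Seq → Set ℓ₁
  s ≋ t = ∀ n → s n ≈ t n

  -- Polynomials in the shift S acting on sequences.  They are kept as
  -- expressions so that the Frobenius twist of their coefficients is defined by
  -- recursion.
  data Op : Set c where
    con     : Carrier → Op
    S       : Op
    _⊕_ _⊗_ : Op → Op → Op

  ⟪_⟫ : Op → Seq → Seq
  ⟪ con a ⟫ s n = a * s n
  ⟪ S     ⟫ s n = s (suc n)
  ⟪ P ⊕ Q ⟫ s n = ⟪ P ⟫ s n + ⟪ Q ⟫ s n
  ⟪ P ⊗ Q ⟫ s   = ⟪ P ⟫ (⟪ Q ⟫ s)

  ⟪⟫-cong : ∀ P {s t} → s ≋ t → ⟪ P ⟫ s ≋ ⟪ P ⟫ t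
  ⟪⟫-cong (con a) s≋t n = *-congˡ (s≋t n)
  ⟪⟫-cong S       s≋t n = s≋t (suc n)
  ⟪⟫-cong (P ⊕ Q) s≋t n = +-cong (⟪⟫-cong P s≋t n) (⟪⟫-cong Q s≋t n)
  ⟪⟫-cong (P ⊗ Q) s≋t   = ⟪⟫-cong P (⟪⟫-cong Q s≋t)

  ⟪⟫-+ : ∀ P s t → ⟪ P ⟫ (λ n → s n + t n) ≋ (λ n → ⟪ P ⟫ s n + ⟪ P ⟫ t n)
  ⟪⟫-+ (con a) s t n = distribˡ a (s n) (t n)
  ⟪⟫-+ S       s t n = refl
  ⟪⟫-+ (P ⊕ Q) s t n = trans (+-cong (⟪⟫-+ P s t n) (⟪⟫-+ Q s t n))
    (solve 4 (λ a b c d → (a :+ b) :+ (c :+ d) := (a :+ c) :+ (b :+ d)) refl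
      (⟪ P ⟫ s n) (⟪ P ⟫ t n) (⟪ Q ⟫ s n) (⟪ Q ⟫ t n))
  ⟪⟫-+ (P ⊗ Q) s t n = trans (⟪⟫-cong P (⟪⟫-+ Q s t) n) (⟪⟫-+ P (⟪ Q ⟫ s) (⟪ Q ⟫ t) n)

  ⟪⟫-* : ∀ P a s → ⟪ P ⟫ (λ n → a * s n) ≋ (λ n → a * ⟪ P ⟫ s n)
  ⟪⟫-* (con b) a s n = solve 3 (λ a b x → b :* (a :* x) := a :* (b :* x)) refl a b (s n)
  ⟪⟫-* S       a s n = refl
  ⟪⟫-* (P ⊕ Q) a s n = trans (+-cong (⟪⟫-* P a s n) (⟪⟫-* Q a s n)) (sym (distribˡ a _ _))
  ⟪⟫-* (P ⊗ Q) a s n = trans (⟪⟫-cong P (⟪⟫-* Q a s) n) (⟪⟫-* P a (⟪ Q ⟫ s) n)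

  ⟪⟫-suc : ∀ P s → ⟪ P ⟫ (λ n → s (suc n)) ≋ (λ n → ⟪ P ⟫ s (suc n))
  ⟪⟫-suc (con a) s n = refl
  ⟪⟫-suc S       s n = refl
  ⟪⟫-suc (P ⊕ Q) s n = +-cong (⟪⟫-suc P s n) (⟪⟫-suc Q s n)
  ⟪⟫-suc (P ⊗ Q) s n = trans (⟪⟫-cong P (⟪⟫-suc Q s) n) (⟪⟫-suc P (⟪ Q ⟫ s) n)

  ⟪⟫-0 : ∀ P {s} → s ≋ (λ _ → 0#) → ⟪ P ⟫ s ≋ (λ _ → 0#)
  ⟪⟫-0 P {s} s≋0 n = trans
    (⟪⟫-cong P {s} {λ m → 0# * s m} (λ m → trans (s≋0 m) (sym (zeroˡ _))) n)
    (trans (⟪⟫-* P 0# s n) (zeroˡ _))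

  -- Induction on P reduces this to linearity of Q and to its commutation with S.
  ⟪⟫-comm : ∀ P Q s → ⟪ P ⟫ (⟪ Q ⟫ s) ≋ ⟪ Q ⟫ (⟪ P ⟫ s)
  ⟪⟫-comm (con a)   Q s n = sym (⟪⟫-* Q a s n)
  ⟪⟫-comm S         Q s n = sym (⟪⟫-suc Q s n)
  ⟪⟫-comm (P₁ ⊕ P₂) Q s n = trans (+-cong (⟪⟫-comm P₁ Q s n) (⟪⟫-comm P₂ Q s n))
    (sym (⟪⟫-+ Q (⟪ P₁ ⟫ s) (⟪ P₂ ⟫ s) n))
  ⟪⟫-comm (P₁ ⊗ P₂) Q s n = trans (⟪⟫-cong P₁ (⟪⟫-comm P₂ Q s) n) (⟪⟫-comm P₁ Q (⟪ P₂ ⟫ s) n)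

  module OperatorsOn {w} (W : Pred Seq w) where

    infix 4 _≐_
    -- On all sequences this is equality of polynomials; on ker M(S) it plays the role of congruence
    -- modulo M. The record keeps P and Q inferable where the bare function type would unfold.
    record _≐_ (P Q : Op) : Set (c ⊔ ℓ₁ ⊔ w) where
      constructor mk≐
      field on : ∀ {s} → W s → ⟪ P ⟫ s ≋ ⟪ Q ⟫ s
    open _≐_ public

    -- W is not assumed stable under operators, so a hypothesis applies to s itself but not to its
    -- image; commuting the factors brings each one next to s.
    ⊗-cong : ∀ {P P′ Q Q′} → P ≐ P′ → Q ≐ Q′ → P ⊗ Q ≐ P′ ⊗ Q′
    ⊗-cong {P} {P′} {Q} {Q′} P≐P′ Q≐Q′ = mk≐ λ {s} Ws n → begin
      ⟪ P ⟫ (⟪ Q ⟫ s) n      ≈⟨ ⟪⟫-cong P (on Q≐Q′ Ws) n ⟩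
      ⟪ P ⟫ (⟪ Q′ ⟫ s) n     ≈⟨ ⟪⟫-comm P Q′ s n ⟩
      ⟪ Q′ ⟫ (⟪ P ⟫ s) n     ≈⟨ ⟪⟫-cong Q′ (on P≐P′ Ws) n ⟩
      ⟪ Q′ ⟫ (⟪ P′ ⟫ s) n    ≈⟨ ⟪⟫-comm Q′ P′ s n ⟩
      ⟪ P′ ⟫ (⟪ Q′ ⟫ s) n    ∎
      where open SetoidReasoning setoid

    operatorRing : CommutativeRing c (c ⊔ ℓ₁ ⊔ w)
    operatorRing = record
      { Carrier = Op ; _≈_ = _≐_ ; _+_ = _⊕_ ; _*_ = _⊗_
      ; -_ = con (- 1#) ⊗_ ; 0# = con 0# ; 1# = con 1#
      ; isCommutativeRing = record
        { isRing = record
          { +-isAbelianGroup = record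
            { isGroup = record
              { isMonoid = record
                { isSemigroup = record
                  { isMagma = record
                    { isEquivalence = record
                      { refl  = mk≐ λ _ _ → refl
                      ; sym   = λ p → mk≐ λ Ws n → sym (on p Ws n)
                      ; trans = λ p q → mk≐ λ Ws n → trans (on p Ws n) (on q Ws n)
                      }
                    ; ∙-cong = λ p q → mk≐ λ Ws n → +-cong (on p Ws n) (on q Ws n)
                    }
                  ; assoc = λ _ _ _ → mk≐ λ _ _ → +-assoc _ _ _
                  }
                ; identity = (λ _ → mk≐ λ _ _ → trans (+-congʳ (zeroˡ _)) (+-identityˡ _))
                           , (λ _ → mk≐ λ _ _ → trans (+-congˡ (zeroˡ _)) (+-identityʳ _))
                }
              ; inverse = (λ P → mk≐ λ {s} _ n → solve 1 (λ x → (:- :1) :* x :+ x := :0 :* x) refl (⟪ P ⟫ s n) ⟨trans⟩ 0*-irrelevant)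
                        , (λ P → mk≐ λ {s} _ n → solve 1 (λ x → x :+ (:- :1) :* x := :0 :* x) refl (⟪ P ⟫ s n) ⟨trans⟩ 0*-irrelevant)
              ; ⁻¹-cong = ⊗-cong {con (- 1#)} (mk≐ λ _ _ → refl)
              }
            ; comm = λ _ _ → mk≐ λ _ _ → +-comm _ _
            }
          ; *-cong     = ⊗-cong
          ; *-assoc    = λ _ _ _ → mk≐ λ _ _ → refl
          ; *-identity = (λ _ → mk≐ λ _ _ → *-identityˡ _)
                       , (λ P → mk≐ λ {s} _ n → trans (⟪⟫-* P 1# s n) (*-identityˡ _))
          ; distrib    = (λ P Q R → mk≐ λ {s} _ → ⟪⟫-+ P (⟪ Q ⟫ s) (⟪ R ⟫ s))
                       , (λ _ _ _ → mk≐ λ _ _ → refl)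
          }
        ; *-comm = λ P Q → mk≐ λ {s} _ → ⟪⟫-comm P Q s
        }
      }
      where
      infixl 5 _⟨trans⟩_
      _⟨trans⟩_ : ∀ {x y z} → x ≈ y → y ≈ z → x ≈ z
      _⟨trans⟩_ = trans
      0*-irrelevant : ∀ {x y} → 0# * x ≈ 0# * y
      0*-irrelevant = trans (zeroˡ _) (sym (zeroˡ _))

    con-cong : ∀ {a b} → a ≈ b → con a ≐ con b
    con-cong a≈b = mk≐ λ _ _ → *-congʳ a≈b

    con-+ : ∀ a b → con (a + b) ≐ con a ⊕ con b
    con-+ a b = mk≐ λ {s} _ n → distribʳ (s n) a b

    con-* : ∀ a b → con (a * b) ≐ con a ⊗ con b
    con-* a b = mk≐ λ {s} _ n → *-assoc a b (s n)

    con-neg : ∀ a → con (- a) ≐ con (- 1#) ⊗ con a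
    con-neg a = mk≐ λ {s} _ n → solve 2 (λ a x → :- a :* x := (:- :1) :* (a :* x)) refl a (s n)

  module Exact = OperatorsOn {c} (λ _ → ⊤)
  open Exact using (_≐_; mk≐; on; con-cong; con-+; con-*; con-neg) renaming (operatorRing to ring∀) public
  private
    module R = CommutativeRing ring∀
    module RSolver = IntegerSolver ring∀

  infix 8 S−_
  S−_ : Carrier → Op
  S− α = S ⊕ con (- α)

  infixl 8 _at_
  _at_ : Op → Carrier → Carrier
  con a   at x = a
  S       at x = x
  (P ⊕ Q) at x = P at x + Q at x
  (P ⊗ Q) at x = P at x * Q at x

  at-cong : ∀ P {x y} → x ≈ y → P at x ≈ P at y
  at-cong (con a) x≈y = refl
  at-cong S       x≈y = x≈y
  at-cong (P ⊕ Q) x≈y = +-cong (at-cong P x≈y) (at-cong Q x≈y)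
  at-cong (P ⊗ Q) x≈y = *-cong (at-cong P x≈y) (at-cong Q x≈y)

  -- The powers of α form an eigenvector of S with eigenvalue α.
  ⟪⟫-geometric : ∀ P α → ⟪ P ⟫ (α ^_) ≋ (λ n → P at α * α ^ n)
  ⟪⟫-geometric (con a) α n = refl
  ⟪⟫-geometric S       α n = refl
  ⟪⟫-geometric (P ⊕ Q) α n = trans (+-cong (⟪⟫-geometric P α n) (⟪⟫-geometric Q α n)) (sym (distribʳ _ _ _))
  ⟪⟫-geometric (P ⊗ Q) α n = trans (⟪⟫-cong P (⟪⟫-geometric Q α) n) (trans (⟪⟫-* P (Q at α) (α ^_) n)
    (trans (*-congˡ (⟪⟫-geometric P α n))
      (solve 3 (λ p q x → q :* (p :* x) := (p :* q) :* x) refl (P at α) (Q at α) (α ^ n))))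

  -- The value at α is the entry at index 0 of the action on the powers of α, so it depends on the
  -- action and not on the expression.
  ≐⇒at : ∀ {P Q} → P ≐ Q → ∀ α → P at α ≈ Q at α
  ≐⇒at {P} {Q} P≐Q α = begin
    P at α          ≈⟨ *-identityʳ _ ⟨
    P at α * 1#     ≈⟨ ⟪⟫-geometric P α 0 ⟨
    ⟪ P ⟫ (α ^_) 0  ≈⟨ on P≐Q tt 0 ⟩
    ⟪ Q ⟫ (α ^_) 0  ≈⟨ ⟪⟫-geometric Q α 0 ⟩
    Q at α * 1#     ≈⟨ *-identityʳ _ ⟩
    Q at α          ∎
    where open SetoidReasoning setoid

  -- The difference quotient (P(S) - P(α)) / (S - α), with a Leibniz rule for products.
  quotientAt : Op → Carrier → Op
  quotientAt (con a) α = con 0#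
  quotientAt S       α = con 1#
  quotientAt (P ⊕ Q) α = quotientAt P α ⊕ quotientAt Q α
  quotientAt (P ⊗ Q) α = con (P at α) ⊗ quotientAt Q α ⊕ quotientAt P α ⊗ Q

  remainder : ∀ P α → P ≐ con (P at α) ⊕ (S− α) ⊗ quotientAt P α
  remainder (con a) α = RSolver.solve 2 (λ a l → a :=′ a :+′ l :*′ :0′) R.refl (con a) (S− α)
    where open RSolver renaming (_:=_ to _:=′_; _:+_ to _:+′_; _:*_ to _:*′_; :0 to :0′)
  remainder S α = mk≐ λ {s} _ n → solve 3 (λ a x y → x := a :* y :+ (:1 :* x :+ :- a :* (:1 :* y))) refl α (s (suc n)) (s n)
  remainder (P ⊕ Q) α = R.trans (R.+-cong (remainder P α) (remainder Q α))
    (R.trans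
      (RSolver.solve 5 (λ p q l p′ q′ → (p :+′ l :*′ p′) :+′ (q :+′ l :*′ q′) :=′ (p :+′ q) :+′ l :*′ (p′ :+′ q′)) R.refl
        (con (P at α)) (con (Q at α)) (S− α) (quotientAt P α) (quotientAt Q α))
      (R.+-congʳ (R.sym (con-+ _ _))))
    where open RSolver renaming (_:=_ to _:=′_; _:+_ to _:+′_; _:*_ to _:*′_)
  remainder (P ⊗ Q) α = R.trans (R.*-congʳ (remainder P α)) (R.trans
      (RSolver.solve 4 (λ p l p′ Q → (p :+′ l :*′ p′) :*′ Q :=′ p :*′ Q :+′ l :*′ (p′ :*′ Q)) R.refl
        (con (P at α)) (S− α) (quotientAt P α) Q)
      (R.trans (R.+-congʳ (R.*-congˡ (remainder Q α)))
      (R.trans (RSolver.solve 6 (λ p q l p′ q′ Q → p :*′ (q :+′ l :*′ q′) :+′ l :*′ (p′ :*′ Q) :=′ p :*′ q :+′ l :*′ (p :*′ q′ :+′ p′ :*′ Q)) R.refl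
        (con (P at α)) (con (Q at α)) (S− α) (quotientAt P α) (quotientAt Q α) Q)
      (R.+-congʳ (R.sym (con-* _ _))))))
    where open RSolver renaming (_:=_ to _:=′_; _:+_ to _:+′_; _:*_ to _:*′_)

  factor : ∀ P {α} → P at α ≈ 0# → P ≐ (S− α) ⊗ quotientAt P α
  factor P {α} root = R.trans (remainder P α) (R.trans (R.+-congʳ (con-cong root)) (R.+-identityˡ _))

  ∏S− : List Carrier → Op
  ∏S− []       = con 1#
  ∏S− (α ∷ αs) = (S− α) ⊗ ∏S− αs

  σ : ℕ → Seq → Seq
  σ m s n = s n ^ m

  twist : ℕ → Op → Op
  twist m (con a) = con (a ^ m)
  twist m S       = S
  twist m (P ⊕ Q) = twist m P ⊕ twist m Q
  twist m (P ⊗ Q) = twist m P ⊗ twist m Q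

  1^m≈1 : ∀ m → 1# ^ m ≈ 1#
  1^m≈1 zero    = refl
  1^m≈1 (suc m) = trans (*-identityˡ _) (1^m≈1 m)

  0^m≈0 : ∀ {m} → AdditivePower m → 0# ^ m ≈ 0#
  0^m≈0 {m} frob = identityʳ-unique _ _ (trans (sym (frob 0# 0#)) (^-congˡ m (+-identityˡ 0#)))

  neg-^ : ∀ {m} → AdditivePower m → ∀ x → (- x) ^ m ≈ - (x ^ m)
  neg-^ {m} frob x = inverseʳ-unique _ _
    (trans (sym (frob x (- x))) (trans (^-congˡ m (-‿inverseʳ x)) (0^m≈0 {m} frob)))

  -- The power map is a ring endomorphism, so it acts semilinearly on sequences.
  σ-⟪⟫ : ∀ {m} → AdditivePower m → ∀ P s → σ m (⟪ P ⟫ s) ≋ ⟪ twist m P ⟫ (σ m s)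
  σ-⟪⟫ {m} frob (con a) s n = ^-distrib-* a (s n) m
  σ-⟪⟫ frob S       s n = refl
  σ-⟪⟫ frob (P ⊕ Q) s n = trans (frob _ _) (+-cong (σ-⟪⟫ frob P s n) (σ-⟪⟫ frob Q s n))
  σ-⟪⟫ {m} frob (P ⊗ Q) s n = trans (σ-⟪⟫ frob P (⟪ Q ⟫ s) n) (⟪⟫-cong (twist m P) (σ-⟪⟫ frob Q s) n)

  twist-at : ∀ {m} → AdditivePower m → ∀ P {α} → α ^ m ≈ α → twist m P at α ≈ (P at α) ^ m
  twist-at frob (con a) fixed = refl
  twist-at frob S       fixed = sym fixed
  twist-at frob (P ⊕ Q) fixed = trans (+-cong (twist-at frob P fixed) (twist-at frob Q fixed)) (sym (frob _ _))
  twist-at {m} frob (P ⊗ Q) fixed = trans (*-cong (twist-at frob P fixed) (twist-at frob Q fixed)) (sym (^-distrib-* _ _ m))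

  twist-∏S− : ∀ {m} → AdditivePower m → ∀ {αs} → All (λ α → α ^ m ≈ α) αs → twist m (∏S− αs) ≐ ∏S− αs
  twist-∏S− {m} frob []               = con-cong (1^m≈1 m)
  twist-∏S− {m} frob (fixed ∷ fixeds) = R.*-cong
    (R.+-congˡ (con-cong (trans (neg-^ {m} frob _) (-‿cong fixed)))) (twist-∏S− frob fixeds)

  fromPoly : Poly → Op
  fromPoly []      = con 0#
  fromPoly (a ∷ f) = con a ⊕ S ⊗ fromPoly f

  -- For s the iterates of `C[T]` at u, the left side is the Carlitz action; torsion of u thus says
  -- that M(S) s vanishes at index 0.
  sum-lookup : ∀ f s → Sum.sum semiring (λ (i : Fin (length f)) → lookup f i * s (toℕ i)) ≈ ⟪ fromPoly f ⟫ s 0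
  sum-lookup []      s = sym (zeroˡ _)
  sum-lookup (a ∷ f) s = +-congˡ (trans (sum-lookup f (λ n → s (suc n))) (⟪⟫-suc (fromPoly f) s 0))

  fromPoly-cong : ∀ f g → f ≈ₚ g → fromPoly f ≐ fromPoly g
  fromPoly-cong []      []      f≈g = R.refl
  fromPoly-cong []      (b ∷ g) f≈g = R.trans
    (R.sym (R.trans (R.+-identityˡ _) (R.zeroʳ S)))
    (R.+-cong (con-cong (f≈g 0)) (R.*-congˡ (fromPoly-cong [] g (λ n → f≈g (suc n)))))
  fromPoly-cong (a ∷ f) []      f≈g = R.trans
    (R.+-cong (con-cong (f≈g 0)) (R.*-congˡ (fromPoly-cong f [] (λ n → f≈g (suc n)))))
    (R.trans (R.+-identityˡ _) (R.zeroʳ S))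
  fromPoly-cong (a ∷ f) (b ∷ g) f≈g =
    R.+-cong (con-cong (f≈g 0)) (R.*-congˡ (fromPoly-cong f g (λ n → f≈g (suc n))))

  fromPoly-+ : ∀ f g → fromPoly (f +ₚ g) ≐ fromPoly f ⊕ fromPoly g
  fromPoly-+ []      g       = R.sym (R.+-identityˡ _)
  fromPoly-+ (a ∷ f) []      = R.sym (R.+-identityʳ _)
  fromPoly-+ (a ∷ f) (b ∷ g) = R.trans (R.+-cong (con-+ a b) (R.*-congˡ (fromPoly-+ f g)))
    (RSolver.solve 5 (λ a b s f g → (a :+′ b) :+′ s :*′ (f :+′ g) :=′ (a :+′ s :*′ f) :+′ (b :+′ s :*′ g)) R.refl
      (con a) (con b) S (fromPoly f) (fromPoly g))
    where open RSolver renaming (_:=_ to _:=′_; _:+_ to _:+′_; _:*_ to _:*′_)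

  fromPoly-· : ∀ a f → fromPoly (a ·ₚ f) ≐ con a ⊗ fromPoly f
  fromPoly-· a []      = R.sym (R.zeroʳ (con a))
  fromPoly-· a (b ∷ f) = R.trans (R.+-cong (con-* a b) (R.*-congˡ (fromPoly-· a f)))
    (RSolver.solve 4 (λ a b s f → a :*′ b :+′ s :*′ (a :*′ f) :=′ a :*′ (b :+′ s :*′ f)) R.refl (con a) (con b) S (fromPoly f))
    where open RSolver renaming (_:=_ to _:=′_; _:+_ to _:+′_; _:*_ to _:*′_)

  fromPoly-* : ∀ f g → fromPoly (f *ₚ g) ≐ fromPoly f ⊗ fromPoly g
  fromPoly-* []      g = R.sym (R.zeroˡ (fromPoly g))
  fromPoly-* (a ∷ f) g = R.trans (fromPoly-+ (a ·ₚ g) (0# ∷ (f *ₚ g)))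
    (R.trans (R.+-cong (fromPoly-· a g) (R.trans (R.+-identityˡ _) (R.*-congˡ (fromPoly-* f g))))
      (RSolver.solve 4 (λ a s f g → a :*′ g :+′ s :*′ (f :*′ g) :=′ (a :+′ s :*′ f) :*′ g) R.refl (con a) S (fromPoly f) (fromPoly g)))
    where open RSolver renaming (_:=_ to _:=′_; _:+_ to _:+′_; _:*_ to _:*′_)

  fromPoly-∏X- : ∀ αs → fromPoly (foldr _*ₚ_ (1# ∷ []) (map X-_ αs)) ≐ ∏S− αs
  fromPoly-∏X- []       = RSolver.solve 1 (λ s → :1′ :+′ s :*′ :0′ :=′ :1′) R.refl S
    where open RSolver renaming (_:=_ to _:=′_; _:+_ to _:+′_; _:*_ to _:*′_; :0 to :0′; :1 to :1′)
  fromPoly-∏X- (α ∷ αs) = R.trans (fromPoly-* (X- α) _) (R.*-cong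
    (RSolver.solve 2 (λ s α → α :+′ s :*′ (:1′ :+′ s :*′ :0′) :=′ s :+′ α) R.refl S (con (- α))) (fromPoly-∏X- αs))
    where open RSolver renaming (_:=_ to _:=′_; _:+_ to _:+′_; _:*_ to _:*′_; :0 to :0′; :1 to :1′)

  twist-fromPoly : ∀ {m} → AdditivePower m → ∀ {f} → All (λ a → a ^ m ≈ a) f → twist m (fromPoly f) ≐ fromPoly f
  twist-fromPoly {m} frob []               = con-cong (0^m≈0 {m} frob)
  twist-fromPoly frob (fixed ∷ fixeds) = R.+-cong (con-cong fixed) (R.*-congˡ (twist-fromPoly frob fixeds))

-- Inverses and the twist equation modulo a split polynomial.

module TorsionOperators {c ℓ₁ ℓ₂ : Level} (Ω : HeytingField c ℓ₁ ℓ₂)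
                        (_#?_ : Decidable (HeytingField._#_ Ω)) where

  open HeytingField Ω hiding (zero)
  open HeytingCommutativeRing heytingCommutativeRing using (commutativeRing)
  open CommutativeRing commutativeRing using (commutativeSemiring; +-group)
  open HeytingProperties heytingCommutativeRing using (#-congʳ)
  open CommutativeExp commutativeSemiring using (_^_; ^-congˡ; ^-distrib-*)
  open GroupProperties +-group using (x∙y⁻¹≈ε⇒x≈y)
  open Frobenius commutativeSemiring using (AdditivePower)
  open IntegerSolver commutativeRing using (solve; _:+_; _:*_; :-_; _:-_; _:=_; :0; :1)
  open FieldTheory Ω
  open FieldProperties Ω _#?_
  open Operators Ω
  private
    module R = CommutativeRing ring∀
    module RSolver = IntegerSolver ring∀
  open RSolver using () renaming (_:=_ to _:=′_; _:+_ to _:+′_; _:*_ to _:*′_; :-_ to :-′_; :0 to :0′; :1 to :1′)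

  -- The same argument as for Newton interpolation: the inverse modulo
  -- (S − α) D is found by adding a multiple of D to the inverse modulo D.
  inverse-mod : ∀ G αs → (∀ {x} → ∏S− αs at x ≈ 0# → G at x # 0#) →
    ∃[ E ] ∃[ R ] E ⊗ G ≐ con 1# ⊕ R ⊗ ∏S− αs
  inverse-mod G [] G#0 = con 0# , con (- 1#) ,
    R.trans (RSolver.solve 1 (λ g → :0′ :*′ g :=′ :1′ :+′ (:-′ :1′) :*′ :1′) R.refl G)
      (R.+-congˡ (R.*-congʳ (R.*-identityʳ _)))
  inverse-mod G (α ∷ αs) G#0
    with inverse-mod G αs (λ D≈0 → G#0 (trans (*-congˡ D≈0) (zeroʳ _)))
       | inverse (G#0 {α} (trans (*-congʳ (-‿inverseʳ α)) (zeroˡ _)))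
  ... | E , R , eq | z , Gz≈1 = E ⊕ con c′ ⊗ D , quotientAt X α , (begin
    (E ⊕ con c′ ⊗ D) ⊗ G
      ≈⟨ RSolver.solve 4 (λ e c d g → (e :+′ c :*′ d) :*′ g :=′ e :*′ g :+′ c :*′ g :*′ d) R.refl E (con c′) D G ⟩
    E ⊗ G ⊕ con c′ ⊗ G ⊗ D
      ≈⟨ R.+-congʳ eq ⟩
    (con 1# ⊕ R ⊗ D) ⊕ con c′ ⊗ G ⊗ D
      ≈⟨ RSolver.solve 4 (λ r d c g → (:1′ :+′ r :*′ d) :+′ c :*′ g :*′ d :=′ :1′ :+′ (r :+′ c :*′ g) :*′ d) R.refl R D (con c′) G ⟩
    con 1# ⊕ X ⊗ D
      ≈⟨ R.+-congˡ (R.*-congʳ (factor X X-root)) ⟩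
    con 1# ⊕ S− α ⊗ quotientAt X α ⊗ D
      ≈⟨ RSolver.solve 3 (λ l x d → :1′ :+′ l :*′ x :*′ d :=′ :1′ :+′ x :*′ (l :*′ d)) R.refl (S− α) (quotientAt X α) D ⟩
    con 1# ⊕ quotientAt X α ⊗ (S− α ⊗ D) ∎)
    where
    open SetoidReasoning R.setoid
    D = ∏S− αs
    -- Chosen so that R + c′ G vanishes at α, which supplies the extra factor S - α.
    c′ = - (R at α) * z
    X = R ⊕ con c′ ⊗ G
    X-root : X at α ≈ 0#
    X-root = trans (solve 3 (λ r z g → r :+ (:- r :* z) :* g := r :- r :* (g :* z)) refl (R at α) z (G at α))
      (trans (+-congˡ (-‿cong (trans (*-congˡ Gz≈1) (*-identityʳ _)))) (-‿inverseʳ _))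

  module _ {Q : ℕ} (2≤Q : 2 ℕ.≤ Q) (frob : AdditivePower Q) (closed : AlgebraicallyClosed) (T : Carrier) where

    -- A (Q - 1)-th root of b works. With b = α - T this gives the value prescribed for G at a new
    -- root α.
    kummer-root : ∀ {b} → b # 0# → ∃[ v ] v # 0# × v ^ Q ≈ b * v
    kummer-root {b} b#0 = go 2≤Q
      where
      go : ∀ {Q} → 2 ℕ.≤ Q → ∃[ v ] v # 0# × v ^ Q ≈ b * v
      go (ℕ.s≤s 1≤m@(ℕ.s≤s _)) with nth-root closed 1≤m b
      ... | v , v^m≈b = v
        , ≉⇒# (λ v≈0 → #⇒≉ b#0 (trans (sym v^m≈b) (trans (*-congʳ v≈0) (zeroˡ _))))
        , trans (*-congˡ v^m≈b) (*-comm v b)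

    -- The value x extends a solution G modulo D to the solution G + x D modulo
    -- (S − α) D; when α is a new root, x prescribes a nonzero value at α.
    extension-coefficient : ∀ {α} → α ^ Q ≈ α → α # T → ∀ G R D → twist Q D ≐ D →
      twist Q G ≐ S− T ⊗ G ⊕ R ⊗ D →
      ∃[ x ] R at α + ((- (α - T)) * x + x ^ Q) ≈ 0# × (D at α # 0# → G at α + x * D at α # 0#)
    extension-coefficient {α} fixed α#T G R D twist-D twist-G with ≈⊎# (D at α) 0#
    -- Here D already vanishes at α, so x cannot change the value of G there; only divisibility of
    -- the new remainder by S - α is at stake.
    ... | inj₁ D≈0 with trinomial-root closed 2≤Q (R at α) (- (α - T))
    ...   | x , root = x , root , λ D#0 → ⊥-elim (#⇒≉ D#0 D≈0)
    extension-coefficient {α} fixed α#T G R D twist-D twist-G | inj₂ D#0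
      with inverse D#0 | kummer-root (≉⇒# λ eq → #⇒≉ α#T (x∙y⁻¹≈ε⇒x≈y α T eq))
    ... | z , Dz≈1 | v , v#0 , v^Q = x , xy≈0⇒y≈0 D#0 vanishes , λ _ → #-congʳ (sym value) v#0
      where
      open SetoidReasoning setoid
      g = G at α
      r = R at α
      δ = D at α
      -- Solves G(α) + x D(α) = v.
      x = (v - g) * z
      value : g + x * δ ≈ v
      value = trans (solve 4 (λ g v z δ → g :+ (v :- g) :* z :* δ := g :+ (v :- g) :* (δ :* z)) refl g v z δ)
        (trans (+-congˡ (trans (*-congˡ Dz≈1) (*-identityʳ _))) (solve 2 (λ g v → g :+ (v :- g) := v) refl g v))
      g^Q : g ^ Q ≈ (α - T) * g + r * δ
      g^Q = trans (sym (twist-at frob G fixed)) (≐⇒at twist-G α)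
      δ^Q : δ ^ Q ≈ δ
      δ^Q = trans (sym (twist-at frob D fixed)) (≐⇒at twist-D α)
      v^Q-expanded : v ^ Q ≈ ((α - T) * g + r * δ) + x ^ Q * δ
      v^Q-expanded = begin
        v ^ Q                          ≈⟨ ^-congˡ Q value ⟨
        (g + x * δ) ^ Q                ≈⟨ frob g (x * δ) ⟩
        g ^ Q + (x * δ) ^ Q            ≈⟨ +-cong g^Q (trans (^-distrib-* x δ Q) (*-congˡ δ^Q)) ⟩
        ((α - T) * g + r * δ) + x ^ Q * δ  ∎
      -- D(α) times the new remainder at α is v^Q - (α - T) v, which is zero by the choice of v.
      vanishes : δ * (r + ((- (α - T)) * x + x ^ Q)) ≈ 0#
      vanishes = begin
        δ * (r + ((- (α - T)) * x + x ^ Q))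
          ≈⟨ solve 6 (λ δ r a x y g → δ :* (r :+ ((:- a) :* x :+ y)) := ((a :* g :+ r :* δ) :+ y :* δ) :- a :* (g :+ x :* δ))
               refl δ r (α - T) x (x ^ Q) g ⟩
        (((α - T) * g + r * δ) + x ^ Q * δ) - (α - T) * (g + x * δ)
          ≈⟨ +-cong (trans (sym v^Q-expanded) v^Q) (-‿cong (*-congˡ value)) ⟩
        (α - T) * v - (α - T) * v
          ≈⟨ -‿inverseʳ _ ⟩
        0# ∎

    -- Replacing G by G + x D turns R into R + x^Q - x (S - T), and this must vanish at α to yield
    -- the factor S - α. Hence R is carried through the induction.
    twist-solution : ∀ {αs} → All (λ α → α ^ Q ≈ α × α # T) αs →
      ∃[ G ] ∃[ R ] twist Q G ≐ S− T ⊗ G ⊕ R ⊗ ∏S− αs × (∀ {x} → ∏S− αs at x ≈ 0# → G at x # 0#)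
    -- Modulo 1 there is nothing to solve, and no root to avoid.
    twist-solution [] = con 0# , con 0#
      , R.trans (con-cong (0^m≈0 {Q} frob)) (RSolver.solve 1 (λ l → :0′ :=′ l :*′ :0′ :+′ :0′ :*′ :1′) R.refl (S− T))
      , λ 1≈0 → ⊥-elim (1≉0 1≈0)
    twist-solution {α ∷ αs} ((fixed , α#T) ∷ rest) with twist-solution rest
    ... | G , R , twist-G , G#0
      with extension-coefficient fixed α#T G R (∏S− αs) (twist-∏S− frob (All.map proj₁ rest)) twist-G
    ... | x , x-root , x#0 = G ⊕ con x ⊗ D , quotientAt X α , (begin
      twist Q G ⊕ con (x ^ Q) ⊗ twist Q D
        ≈⟨ R.+-cong twist-G (R.*-congˡ (twist-∏S− frob (All.map proj₁ rest))) ⟩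
      (S− T ⊗ G ⊕ R ⊗ D) ⊕ con (x ^ Q) ⊗ D
        ≈⟨ RSolver.solve 6 (λ l g r d c y → (l :*′ g :+′ r :*′ d) :+′ y :*′ d :=′
             l :*′ (g :+′ c :*′ d) :+′ (r :+′ (y :+′ (:-′ c) :*′ l)) :*′ d) R.refl (S− T) G R D (con x) (con (x ^ Q)) ⟩
      S− T ⊗ (G ⊕ con x ⊗ D) ⊕ (R ⊕ (con (x ^ Q) ⊕ (con (- 1#) ⊗ con x) ⊗ S− T)) ⊗ D
        ≈⟨ R.+-congˡ (R.*-congʳ (R.+-congˡ (R.+-congˡ (R.*-congʳ (con-neg x))))) ⟨
      S− T ⊗ (G ⊕ con x ⊗ D) ⊕ X ⊗ D
        ≈⟨ R.+-congˡ (R.*-congʳ (factor X X-root)) ⟩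
      S− T ⊗ (G ⊕ con x ⊗ D) ⊕ S− α ⊗ quotientAt X α ⊗ D
        ≈⟨ R.+-congˡ (RSolver.solve 3 (λ l x d → l :*′ x :*′ d :=′ x :*′ (l :*′ d)) R.refl (S− α) (quotientAt X α) D) ⟩
      S− T ⊗ (G ⊕ con x ⊗ D) ⊕ quotientAt X α ⊗ (S− α ⊗ D) ∎)
      , nonzero
      where
      open SetoidReasoning R.setoid
      D = ∏S− αs
      X = R ⊕ (con (x ^ Q) ⊕ con (- x) ⊗ S− T)
      X-root : X at α ≈ 0#
      X-root = trans
        (solve 5 (λ r y x α t → r :+ (y :+ (:- x) :* (α :+ :- t)) := r :+ ((:- (α :- t)) :* x :+ y)) refl
          (R at α) (x ^ Q) x α T) x-root
      nonzero : ∀ {y} → (S− α ⊗ D) at y ≈ 0# → (G ⊕ con x ⊗ D) at y # 0#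
      nonzero {y} root with ≈⊎# (D at y) 0#
      ... | inj₁ D≈0 = #-congʳ (sym (trans (+-congˡ (trans (*-congˡ D≈0) (zeroʳ x))) (+-identityʳ _))) (G#0 D≈0)
      ... | inj₂ D#0 = #-congʳ (at-cong (G ⊕ con x ⊗ D) (sym y≈α)) (x#0 (#-congʳ (at-cong D y≈α) D#0))
        where
        y≈α : y ≈ α
        y≈α = x∙y⁻¹≈ε⇒x≈y y α (xy≈0⇒y≈0 D#0 (trans (*-comm _ _) root))

  -- Sequences annihilated by a split polynomial.

  -- A right inverse of S - α. Applied repeatedly to the powers of α, it yields the sequences (n
  -- choose j) α^(n-j) that repeated roots require.
  lift : Carrier → Seq → Seq
  lift α t zero    = 0#
  lift α t (suc n) = α * lift α t n + t n

  lift-cong : ∀ α {s t} → s ≋ t → lift α s ≋ lift α t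
  lift-cong α s≋t zero    = refl
  lift-cong α s≋t (suc n) = +-cong (*-congˡ (lift-cong α s≋t n)) (s≋t n)

  lift-+ : ∀ α s t → lift α (λ n → s n + t n) ≋ (λ n → lift α s n + lift α t n)
  lift-+ α s t zero    = sym (+-identityˡ 0#)
  lift-+ α s t (suc n) = trans (+-congʳ (*-congˡ (lift-+ α s t n)))
    (solve 5 (λ α a b x y → α :* (a :+ b) :+ (x :+ y) := (α :* a :+ x) :+ (α :* b :+ y)) refl
      α (lift α s n) (lift α t n) (s n) (t n))

  lift-* : ∀ α a s → lift α (λ n → a * s n) ≋ (λ n → a * lift α s n)
  lift-* α a s zero    = sym (zeroʳ a)
  lift-* α a s (suc n) = trans (+-congʳ (*-congˡ (lift-* α a s n)))
    (solve 4 (λ α a x y → α :* (a :* x) :+ a :* y := a :* (α :* x :+ y)) refl α a (lift α s n) (s n))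

  S−-lift : ∀ α t → ⟪ S− α ⟫ (lift α t) ≋ t
  S−-lift α t n = solve 3 (λ α x y → (α :* x :+ y) :+ :- α :* x := y) refl α (lift α t n) (t n)

  S−-geometric : ∀ α → ⟪ S− α ⟫ (α ^_) ≋ (λ _ → 0#)
  S−-geometric α n = solve 2 (λ α x → α :* x :+ :- α :* x := :0) refl α (α ^ n)

  -- Both sides agree at index 0 and have the same image under S - α.
  lift-decomposition : ∀ α s → s ≋ (λ n → lift α (⟪ S− α ⟫ s) n + s 0 * α ^ n)
  lift-decomposition α s zero    = sym (trans (+-identityˡ _) (*-identityʳ _))
  lift-decomposition α s (suc n) = begin
    s (suc n)
      ≈⟨ solve 3 (λ α x y → y := α :* x :+ (y :+ :- α :* x)) refl α (s n) (s (suc n)) ⟩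
    α * s n + ⟪ S− α ⟫ s n
      ≈⟨ +-congʳ (*-congˡ (lift-decomposition α s n)) ⟩
    α * (lift α (⟪ S− α ⟫ s) n + s 0 * α ^ n) + ⟪ S− α ⟫ s n
      ≈⟨ solve 5 (λ α l x p d → α :* (l :+ x :* p) :+ d := (α :* l :+ d) :+ x :* (α :* p)) refl
           α (lift α (⟪ S− α ⟫ s) n) (s 0) (α ^ n) (⟪ S− α ⟫ s n) ⟩
    lift α (⟪ S− α ⟫ s) (suc n) + s 0 * (α * α ^ n) ∎
    where open SetoidReasoning setoid

  ^-closed : ∀ {a} (k : Subfield a) {x} → x ∈ ⟦ k ⟧ → ∀ n → x ^ n ∈ ⟦ k ⟧
  ^-closed k x∈k zero    = Subfield.1-closed k
  ^-closed k x∈k (suc n) = Subfield.*-closed k x∈k (^-closed k x∈k n)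

  module _ {a b} (k : Subfield a) (K : Subfield b) where

    private
      module k = Subfield k
      module K = Subfield K

    lift-closed : ∀ {α t} → α ∈ ⟦ k ⟧ → (∀ n → t n ∈ ⟦ k ⟧) → ∀ n → lift α t n ∈ ⟦ k ⟧
    lift-closed α∈k t∈k zero    = k.0-closed
    lift-closed α∈k t∈k (suc n) = k.+-closed (k.*-closed α∈k (lift-closed α∈k t∈k n)) (t∈k n)

    -- ker ∏(S − α) has a basis of sequences over k, so a linear functional that
    -- is K-valued on the sequences over k is K-valued on those over K.
    functional-closed : ⟦ k ⟧ ⊆ ⟦ K ⟧ → ∀ {αs} → All ⟦ k ⟧ αs → (Φ : Seq → Carrier) →
      (∀ {s t} → s ≋ t → Φ s ≈ Φ t) →
      (∀ s t → Φ (λ n → s n + t n) ≈ Φ s + Φ t) →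
      (∀ x s → Φ (λ n → x * s n) ≈ x * Φ s) →
      (∀ {s} → (∀ n → s n ∈ ⟦ k ⟧) → ⟪ ∏S− αs ⟫ s ≋ (λ _ → 0#) → Φ s ∈ ⟦ K ⟧) →
      ∀ {s} → (∀ n → s n ∈ ⟦ K ⟧) → ⟪ ∏S− αs ⟫ s ≋ (λ _ → 0#) → Φ s ∈ ⟦ K ⟧
    functional-closed k⊆K [] Φ Φ-cong Φ-+ Φ-* Φ∈K s∈K s-root =
      Φ∈K (λ n → k.respects (sym (trans (sym (*-identityˡ _)) (s-root n))) k.0-closed) s-root
    functional-closed k⊆K {α ∷ αs} (α∈k ∷ αs∈k) Φ Φ-cong Φ-+ Φ-* Φ∈K {s} s∈K s-root =
      K.respects (sym (trans (Φ-cong (lift-decomposition α s)) (trans (Φ-+ _ _) (+-congˡ (Φ-* (s 0) (α ^_))))))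
        (K.+-closed
          -- As α lies in k, lifting preserves sequences over k, so the composite functional
          -- inherits the hypothesis for the shorter product.
          (functional-closed k⊆K αs∈k (λ t → Φ (lift α t))
            (λ s≋t → Φ-cong (lift-cong α s≋t))
            (λ s t → trans (Φ-cong (lift-+ α s t)) (Φ-+ _ _))
            (λ x s → trans (Φ-cong (lift-* α x s)) (Φ-* _ _))
            (λ {t} t∈k t-root → Φ∈K (lift-closed α∈k t∈k) (λ n →
              trans (⟪⟫-comm (S− α) (∏S− αs) (lift α t) n) (trans (⟪⟫-cong (∏S− αs) (S−-lift α t) n) (t-root n))))
            (λ n → K.+-closed (s∈K (suc n)) (K.*-closed (K.neg-closed (k⊆K α∈k)) (s∈K n)))
            (λ n → trans (⟪⟫-comm (∏S− αs) (S− α) s n) (s-root n)))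
          (K.*-closed (s∈K 0) (Φ∈K (^-closed k α∈k) (λ n →
            trans (⟪⟫-comm (S− α) (∏S− αs) (α ^_) n) (⟪⟫-0 (∏S− αs) (S−-geometric α) n)))))

-- Comparison of the torsion for q and for Q.

2≤n^m : ∀ {n m} → 2 ≤ n → 1 ≤ m → 2 ≤ n ℕ.^ m
2≤n^m {n} {suc m} 2≤n _ = ℕₚ.≤-trans 2≤n (ℕₚ.m≤m*n n (n ℕ.^ m) {{ℕₚ.m^n≢0 n m {{ℕ.>-nonZero (ℕₚ.<⇒≤ 2≤n)}}}})

iterate-comm : ∀ {a} {A : Set a} (f : A → A) x n → iterate f (f x) n ≡ f (iterate f x n)
iterate-comm f x zero    = ≡.refl
iterate-comm f x (suc n) = iterate-comm f (f x) n

module CarlitzTorsion {c ℓ₁ ℓ₂ : Level} (Ω : HeytingField c ℓ₁ ℓ₂)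
                      (_#?_ : Decidable (HeytingField._#_ Ω)) where

  open HeytingField Ω hiding (zero)
  open HeytingCommutativeRing heytingCommutativeRing using (commutativeRing)
  open CommutativeRing commutativeRing using (semiring; commutativeSemiring; +-group)
  open CommutativeExp commutativeSemiring using (_^_; ^-congˡ; ^-congʳ; ^-assocʳ)
  open GroupProperties +-group using (x∙y⁻¹≈ε⇒x≈y)
  open Frobenius commutativeSemiring using (AdditivePower; additivePower-^)
  open IntegerSolver commutativeRing using (solve; _:+_; _:*_; :-_; _:=_)
  open FieldTheory Ω
  open FieldProperties Ω _#?_
  open Operators Ω
  open TorsionOperators Ω _#?_

  ^-fixed : ∀ {x m} → x ^ m ≈ x → ∀ i → x ^ (m ℕ.^ i) ≈ x
  ^-fixed         fixed zero    = *-identityʳ _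
  ^-fixed {x} {m} fixed (suc i) = trans (sym (^-assocʳ x m (m ℕ.^ i))) (trans (^-congˡ (m ℕ.^ i) fixed) (^-fixed fixed i))

  ^-comm : ∀ x m n → (x ^ m) ^ n ≈ (x ^ n) ^ m
  ^-comm x m n = trans (^-assocʳ x m n) (trans (^-congʳ x (ℕₚ.*-comm m n)) (sym (^-assocʳ x n m)))

  module _ (M : Poly) where

    M-torsion : Pred Seq ℓ₁
    M-torsion s = ⟪ fromPoly M ⟫ s ≋ (λ _ → 0#)

    ⟪⟫-torsion : ∀ P {s} → M-torsion s → M-torsion (⟪ P ⟫ s)
    ⟪⟫-torsion P {s} s-tor n = trans (⟪⟫-comm (fromPoly M) P s n) (⟪⟫-0 P s-tor n)

    open OperatorsOn M-torsion using (operatorRing) renaming (_≐_ to _≐ᵂ_; mk≐ to mk≐ᵂ; on to onᵂ; con-cong to con-congᵂ)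
    private
      module W = CommutativeRing operatorRing
      module WSolver = IntegerSolver operatorRing
    open WSolver using () renaming (_:=_ to _:=′_; _:*_ to _:*′_)

    ≐⇒≐ᵂ : ∀ {P P′} → P ≐ P′ → P ≐ᵂ P′
    ≐⇒≐ᵂ P≐P′ = mk≐ᵂ λ _ → on P≐P′ _

    twist-comm : ∀ m n P → twist m (twist n P) ≐ᵂ twist n (twist m P)
    twist-comm m n (con a) = con-congᵂ (^-comm a n m)
    twist-comm m n S       = W.refl
    twist-comm m n (P ⊕ Q) = W.+-cong (twist-comm m n P) (twist-comm m n Q)
    twist-comm m n (P ⊗ Q) = W.*-cong (twist-comm m n P) (twist-comm m n Q)

    module _ (closed : AlgebraicallyClosed) {m : ℕ} (1≤m : 1 ≤ m) (frob : AdditivePower m)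
             (M-fixed : All (λ a → a ^ m ≈ a) M) where

      -- Entrywise roots stay in ker M(S): σ commutes with M(S), whose coefficients are fixed, and
      -- only 0 has m-th power 0.
      σ-torsion-root : ∀ {s} → M-torsion s → ∃[ t ] M-torsion t × σ m t ≋ s
      σ-torsion-root {s} s-tor = t , (λ n → x^n≈0⇒x≈0 m (begin
          ⟪ fromPoly M ⟫ t n ^ m                ≈⟨ σ-⟪⟫ frob (fromPoly M) t n ⟩
          ⟪ twist m (fromPoly M) ⟫ (σ m t) n    ≈⟨ on (twist-fromPoly frob M-fixed) _ n ⟩
          ⟪ fromPoly M ⟫ (σ m t) n              ≈⟨ ⟪⟫-cong (fromPoly M) σt≋s n ⟩
          ⟪ fromPoly M ⟫ s n                    ≈⟨ s-tor n ⟩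
          0#                                    ∎)) , σt≋s
        where
        open SetoidReasoning setoid
        t : Seq
        t n = proj₁ (nth-root closed 1≤m (s n))
        σt≋s : σ m t ≋ s
        σt≋s n = proj₂ (nth-root closed 1≤m (s n))

      -- Every s in W is σ t with t in W, and the twisted operators send s to the m-th powers of
      -- what P and P′ give on t.
      twist-cong : ∀ {P P′} → P ≐ᵂ P′ → twist m P ≐ᵂ twist m P′
      twist-cong {P} {P′} P≐P′ = mk≐ᵂ λ {s} s-tor n →
        let t , t-tor , σt≋s = σ-torsion-root s-tor in begin
        ⟪ twist m P ⟫ s n           ≈⟨ ⟪⟫-cong (twist m P) σt≋s n ⟨
        ⟪ twist m P ⟫ (σ m t) n     ≈⟨ σ-⟪⟫ frob P t n ⟨
        ⟪ P ⟫ t n ^ m               ≈⟨ ^-congˡ m (onᵂ P≐P′ t-tor n) ⟩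
        ⟪ P′ ⟫ t n ^ m              ≈⟨ σ-⟪⟫ frob P′ t n ⟩
        ⟪ twist m P′ ⟫ (σ m t) n    ≈⟨ ⟪⟫-cong (twist m P′) σt≋s n ⟩
        ⟪ twist m P′ ⟫ s n          ∎
        where open SetoidReasoning setoid

    module _ {a b} (closed : AlgebraicallyClosed) (q d : ℕ) (2≤q : 2 ≤ q) (1≤d : 1 ≤ d)
             (frob : AdditivePower q) (M-fixed : All (λ a → a ^ q ≈ a) M)
             (k : Subfield a) (fixed⇔k : ∀ {x} → (x ^ (q ℕ.^ d) ≈ x → x ∈ ⟦ k ⟧) × (x ∈ ⟦ k ⟧ → x ^ (q ℕ.^ d) ≈ x))
             (T : Carrier) (T∉k : ¬ T ∈ ⟦ k ⟧) (M-nonzero : Nonzero M) (splits : Splits k M)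
             (K : Subfield b) (k⊆K : ⟦ k ⟧ ⊆ ⟦ K ⟧) (T∈K : T ∈ ⟦ K ⟧)
             (torsion⊆K : Carlitz.Torsion T (q ℕ.^ d) M ⊆ ⟦ K ⟧) where

      open Carlitz T
      private
        module K = Subfield K
        Q = q ℕ.^ d
        αs = proj₁ (proj₂ splits)
        lead = proj₁ splits

        αs∈k : All ⟦ k ⟧ αs
        αs∈k = proj₁ (proj₂ (proj₂ (proj₂ splits)))

        1≤q^ : ∀ i → 1 ≤ q ℕ.^ i
        1≤q^ i = ℕₚ.m^n>0 q {{ℕ.>-nonZero (ℕₚ.<⇒≤ 2≤q)}} i

        2≤Q : 2 ≤ Q
        2≤Q = 2≤n^m 2≤q 1≤d

        frob^ : ∀ i → AdditivePower (q ℕ.^ i)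
        frob^ = additivePower-^ {q} frob

        M-fixed^ : ∀ i → All (λ a → a ^ (q ℕ.^ i) ≈ a) M
        M-fixed^ i = All.map (λ fixed → ^-fixed fixed i) M-fixed

        lead#0 : lead # 0#
        lead#0 = ≉⇒# λ lead≈0 → #⇒≉ (proj₂ M-nonzero)
          (trans (proj₂ (proj₂ (proj₂ (proj₂ splits))) (proj₁ M-nonzero)) (coeff-· lead≈0 (foldr _*ₚ_ (1# ∷ []) (map X-_ αs)) _))
          where
          coeff-· : ∀ {a} → a ≈ 0# → ∀ f n → coeff (a ·ₚ f) n ≈ 0#
          coeff-· a≈0 []      n       = refl
          coeff-· a≈0 (b ∷ f) zero    = trans (*-congʳ a≈0) (zeroˡ b)
          coeff-· a≈0 (b ∷ f) (suc n) = coeff-· a≈0 f n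

        M≐∏ : fromPoly M ≐ con lead ⊗ ∏S− αs
        M≐∏ = ≐-trans (fromPoly-cong M _ (proj₂ (proj₂ (proj₂ (proj₂ splits)))))
          (≐-trans (fromPoly-· lead (foldr _*ₚ_ (1# ∷ []) (map X-_ αs))) (CommutativeRing.*-congˡ ring∀ {con lead} (fromPoly-∏X- αs)))
          where open CommutativeRing ring∀ using () renaming (trans to ≐-trans)

        torsion⇒∏ : ∀ {s} → M-torsion s → ⟪ ∏S− αs ⟫ s ≋ (λ _ → 0#)
        torsion⇒∏ s-tor n = xy≈0⇒y≈0 lead#0 (trans (sym (on M≐∏ _ n)) (s-tor n))

        ∏⇒torsion : ∀ {s} → ⟪ ∏S− αs ⟫ s ≋ (λ _ → 0#) → M-torsion s
        ∏⇒torsion s-root n = trans (on M≐∏ _ n) (trans (*-congˡ (s-root n)) (zeroʳ lead))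

        solution = twist-solution 2≤Q (frob^ d) closed T
          (All.map (λ α∈k → proj₂ fixed⇔k α∈k , ≉⇒# (λ α≈T → T∉k (Subfield.respects k α≈T α∈k))) αs∈k)
        G = proj₁ solution

        ∏-vanishes : ∀ P R → P ⊕ R ⊗ ∏S− αs ≐ᵂ P
        ∏-vanishes P R = mk≐ᵂ λ s-tor n → trans (+-congˡ (⟪⟫-0 R (torsion⇒∏ s-tor) n)) (+-identityʳ _)

        twist-G : twist Q G ≐ᵂ S− T ⊗ G
        twist-G = W.trans (≐⇒≐ᵂ (proj₁ (proj₂ (proj₂ solution)))) (∏-vanishes (S− T ⊗ G) _)

        G-inverse = inverse-mod G αs (proj₂ (proj₂ (proj₂ solution)))
        G⁻¹ = proj₁ G-inverse

        G⁻¹⊗G : G⁻¹ ⊗ G ≐ᵂ con 1#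
        G⁻¹⊗G = W.trans (≐⇒≐ᵂ (proj₂ (proj₂ G-inverse))) (∏-vanishes (con 1#) _)

        -- `B i` is the product of S - T^(q^j) over j < i. Partial products allow induction on i;
        -- the case i = d is the one wanted.
        B H H⁻¹ : ℕ → Op
        B zero    = con 1#
        B (suc i) = twist (q ℕ.^ i) (S− T) ⊗ B i
        H zero    = con 1#
        H (suc i) = twist (q ℕ.^ i) G ⊗ H i
        H⁻¹ zero    = con 1#
        H⁻¹ (suc i) = twist (q ℕ.^ i) G⁻¹ ⊗ H⁻¹ i

        twistᵢ-cong : ∀ i {P P′} → P ≐ᵂ P′ → twist (q ℕ.^ i) P ≐ᵂ twist (q ℕ.^ i) P′
        twistᵢ-cong i = twist-cong closed (1≤q^ i) (frob^ i) (M-fixed^ i)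

        twist-1 : ∀ m → twist m (con 1#) ≐ᵂ con 1#
        twist-1 m = con-congᵂ (1^m≈1 m)

        H⁻¹⊗H : ∀ i → H⁻¹ i ⊗ H i ≐ᵂ con 1#
        H⁻¹⊗H zero    = W.*-identityˡ _
        H⁻¹⊗H (suc i) = W.trans
          (WSolver.solve 4 (λ g′ h′ g h → (g′ :*′ h′) :*′ (g :*′ h) :=′ (g′ :*′ g) :*′ (h′ :*′ h)) W.refl
            (twist (q ℕ.^ i) G⁻¹) (H⁻¹ i) (twist (q ℕ.^ i) G) (H i))
          (W.trans (W.*-cong (W.trans (twistᵢ-cong i G⁻¹⊗G) (twist-1 (q ℕ.^ i))) (H⁻¹⊗H i)) (W.*-identityˡ _))

        -- Twists commute, so twisting the equation of G by q^i gives each factor of H its own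
        -- factor of B.
        twist-H : ∀ i → twist Q (H i) ≐ᵂ B i ⊗ H i
        twist-H zero    = W.trans (twist-1 Q) (W.sym (W.*-identityˡ _))
        twist-H (suc i) = W.trans
          (W.*-cong (W.trans (twist-comm Q (q ℕ.^ i) G) (twistᵢ-cong i twist-G)) (twist-H i))
          (WSolver.solve 4 (λ l g b h → (l :*′ g) :*′ (b :*′ h) :=′ (l :*′ b) :*′ (g :*′ h)) W.refl
            (twist (q ℕ.^ i) (S− T)) (twist (q ℕ.^ i) G) (B i) (H i))

        K-valued k-valued : Seq → Set _
        K-valued s = ∀ n → s n ∈ ⟦ K ⟧
        k-valued s = ∀ n → s n ∈ ⟦ k ⟧

        G-k-valued : ∀ {s} → k-valued s → M-torsion s → K-valued (⟪ G ⟫ s)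
        G-k-valued {s} s∈k s-tor = w∈K
          where
          open SetoidReasoning setoid
          w = ⟪ G ⟫ s
          w-suc : ∀ n → w (suc n) ≈ C[T] Q (w n)
          w-suc n = begin
            w (suc n)                          ≈⟨ solve 3 (λ t x y → y := t :* x :+ (y :+ :- t :* x)) refl T (w n) (w (suc n)) ⟩
            T * w n + ⟪ S− T ⟫ w n             ≈⟨ +-congˡ (onᵂ twist-G s-tor n) ⟨
            T * w n + ⟪ twist Q G ⟫ s n        ≈⟨ +-congˡ (⟪⟫-cong (twist Q G) (λ m → proj₂ fixed⇔k (s∈k m)) n) ⟨
            T * w n + ⟪ twist Q G ⟫ (σ Q s) n  ≈⟨ +-congˡ (σ-⟪⟫ {Q} (frob^ d) G s n) ⟨
            T * w n + w n ^ Q                  ∎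
          w-iterate : ∀ n → iterate (C[T] Q) (w 0) n ≈ w n
          w-iterate zero    = refl
          w-iterate (suc n) = trans (reflexive (iterate-comm (C[T] Q) (w 0) n))
            (trans (+-cong (*-congˡ (w-iterate n)) (^-congˡ Q (w-iterate n))) (sym (w-suc n)))
          w∈K : K-valued w
          -- Torsion is needed at index 0 only; K contains T, so the recursion supplies the other
          -- entries.
          w∈K zero    = torsion⊆K (trans (sum-lookup M (iterate (C[T] Q) (w 0)))
            (trans (⟪⟫-cong (fromPoly M) w-iterate 0) (⟪⟫-torsion G s-tor 0)))
          w∈K (suc n) = K.respects (sym (w-suc n)) (K.+-closed (K.*-closed T∈K (w∈K n)) (^-closed K (w∈K n) Q))

        -- Write s = σ t for the q^i-th power map. The finite field k contains the q^i-th roots of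
        -- its elements, so G t has entries in K, and the entries wanted are their q^i-th powers.
        twist-G-k-valued : ∀ i {s} → k-valued s → M-torsion s → K-valued (⟪ twist (q ℕ.^ i) G ⟫ s)
        twist-G-k-valued i {s} s∈k s-tor n =
          let t , t-tor , σt≋s = σ-torsion-root closed (1≤q^ i) (frob^ i) (M-fixed^ i) s-tor in
          K.respects (trans (σ-⟪⟫ {q ℕ.^ i} (frob^ i) G t n) (⟪⟫-cong (twist (q ℕ.^ i) G) σt≋s n))
            (^-closed K (G-k-valued (λ m → proj₁ fixed⇔k (root-fixed (σt≋s m) (s∈k m))) t-tor n) (q ℕ.^ i))
          where
          root-fixed : ∀ {x y} → x ^ (q ℕ.^ i) ≈ y → y ∈ ⟦ k ⟧ → x ^ Q ≈ x
          root-fixed {x} {y} x^≈y y∈k = x∙y⁻¹≈ε⇒x≈y _ _ (x^n≈0⇒x≈0 (q ℕ.^ i) (begin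
            (x ^ Q - x) ^ (q ℕ.^ i)                     ≈⟨ frob^ i _ _ ⟩
            (x ^ Q) ^ (q ℕ.^ i) + (- x) ^ (q ℕ.^ i)     ≈⟨ +-cong (^-comm x Q (q ℕ.^ i)) (neg-^ {q ℕ.^ i} (frob^ i) x) ⟩
            (x ^ (q ℕ.^ i)) ^ Q - x ^ (q ℕ.^ i)         ≈⟨ +-cong (^-congˡ Q x^≈y) (-‿cong x^≈y) ⟩
            y ^ Q - y                                   ≈⟨ x≈y⇒x-y≈0 (proj₂ fixed⇔k y∈k) ⟩
            0#                                          ∎))
            where open SetoidReasoning setoid

        -- Needed from the second factor of H on, where the input is known only over K; each output
        -- entry is a linear functional of s.
        twist-G-K-valued : ∀ i {s} → K-valued s → M-torsion s → K-valued (⟪ twist (q ℕ.^ i) G ⟫ s)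
        twist-G-K-valued i s∈K s-tor n = functional-closed k K k⊆K αs∈k (λ s → ⟪ P ⟫ s n)
          (λ s≋t → ⟪⟫-cong P s≋t n) (λ s t → ⟪⟫-+ P s t n) (λ x s → ⟪⟫-* P x s n)
          (λ s∈k s-root → twist-G-k-valued i s∈k (∏⇒torsion s-root) n) s∈K (torsion⇒∏ s-tor)
          where P = twist (q ℕ.^ i) G

        H-K-valued : ∀ i {s} → K-valued s → M-torsion s → K-valued (⟪ H i ⟫ s)
        H-K-valued zero    s∈K s-tor n = K.*-closed K.1-closed (s∈K n)
        H-K-valued (suc i) s∈K s-tor   = twist-G-K-valued i (H-K-valued i s∈K s-tor) (⟪⟫-torsion (H i) s-tor)

      torsion-q⊆K : Torsion q M ⊆ ⟦ K ⟧
      torsion-q⊆K {u} u-tor = K.respects (sym (u≋Hv 0)) (H-K-valued d (λ n → k⊆K (proj₁ fixed⇔k (v-fixed n))) (⟪⟫-torsion (H⁻¹ d) s-tor) 0)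
        where
        open SetoidReasoning setoid
        s : Seq
        s = iterate (C[T] q) u

        s-suc : ∀ n → s (suc n) ≈ T * s n + s n ^ q
        s-suc n = reflexive (iterate-comm (C[T] q) u n)

        σs : σ q s ≋ ⟪ S− T ⟫ s
        σs n = trans (solve 3 (λ t x y → y := (t :* x :+ y) :+ :- t :* x) refl T (s n) (s n ^ q)) (+-congʳ (sym (s-suc n)))

        -- Since the twist by q fixes M, each entry of M(S) s is C_q(T) of the preceding one, and
        -- zero propagates from index 0.
        s-tor : M-torsion s
        s-tor zero    = trans (sym (sum-lookup M s)) u-tor
        s-tor (suc n) = begin
          ⟪ fromPoly M ⟫ s (suc n)                                        ≈⟨ ⟪⟫-suc (fromPoly M) s n ⟨
          ⟪ fromPoly M ⟫ (λ m → s (suc m)) n                              ≈⟨ ⟪⟫-cong (fromPoly M) s-suc n ⟩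
          ⟪ fromPoly M ⟫ (λ m → T * s m + s m ^ q) n                      ≈⟨ ⟪⟫-+ (fromPoly M) _ _ n ⟩
          ⟪ fromPoly M ⟫ (λ m → T * s m) n + ⟪ fromPoly M ⟫ (σ q s) n     ≈⟨ +-cong (⟪⟫-* (fromPoly M) T s n) (sym (on (twist-fromPoly {q} frob M-fixed) _ n)) ⟩
          T * ⟪ fromPoly M ⟫ s n + ⟪ twist q (fromPoly M) ⟫ (σ q s) n     ≈⟨ +-congˡ (σ-⟪⟫ {q} frob (fromPoly M) s n) ⟨
          T * ⟪ fromPoly M ⟫ s n + ⟪ fromPoly M ⟫ s n ^ q                 ≈⟨ +-cong (*-congˡ (s-tor n)) (^-congˡ q (s-tor n)) ⟩
          T * 0# + 0# ^ q                                                 ≈⟨ +-cong (zeroʳ T) (0^m≈0 {q} frob) ⟩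
          0# + 0#                                                         ≈⟨ +-identityˡ 0# ⟩
          0#                                                              ∎

        σs-B : ∀ i → σ (q ℕ.^ i) s ≋ ⟪ B i ⟫ s
        σs-B zero    n = trans (*-identityʳ _) (sym (*-identityˡ _))
        σs-B (suc i) n = begin
          s n ^ (q ℕ.* q ℕ.^ i)                                ≈⟨ ^-assocʳ (s n) q (q ℕ.^ i) ⟨
          (s n ^ q) ^ (q ℕ.^ i)                                ≈⟨ ^-congˡ (q ℕ.^ i) (σs n) ⟩
          ⟪ S− T ⟫ s n ^ (q ℕ.^ i)                             ≈⟨ σ-⟪⟫ {q ℕ.^ i} (frob^ i) (S− T) s n ⟩
          ⟪ twist (q ℕ.^ i) (S− T) ⟫ (σ (q ℕ.^ i) s) n         ≈⟨ ⟪⟫-cong (twist (q ℕ.^ i) (S− T)) (σs-B i) n ⟩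
          ⟪ twist (q ℕ.^ i) (S− T) ⟫ (⟪ B i ⟫ s) n             ∎

        v : Seq
        v = ⟪ H⁻¹ d ⟫ s

        H⊗H⁻¹ : H d ⊗ H⁻¹ d ≐ᵂ con 1#
        H⊗H⁻¹ = W.trans (W.*-comm (H d) (H⁻¹ d)) (H⁻¹⊗H d)

        u≋Hv : s ≋ ⟪ H d ⟫ v
        u≋Hv n = sym (trans (onᵂ H⊗H⁻¹ s-tor n) (*-identityˡ _))

        -- Twist H⁻¹ H = 1 by Q, replace the twist of H by B H, and cancel H.
        twist-H⁻¹ : twist Q (H⁻¹ d) ⊗ B d ≐ᵂ H⁻¹ d
        twist-H⁻¹ = W.trans (W.sym (W.*-identityʳ (twist Q E ⊗ B d)))
          (W.trans (W.*-congˡ {twist Q E ⊗ B d} (W.sym H⊗H⁻¹))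
          (W.trans (WSolver.solve 4 (λ e′ b h e → (e′ :*′ b) :*′ (h :*′ e) :=′ (e′ :*′ (b :*′ h)) :*′ e) W.refl (twist Q E) (B d) (H d) E)
          (W.trans (W.*-congʳ {E} (W.*-congˡ {twist Q E} (W.sym (twist-H d))))
          (W.trans (W.*-congʳ {E} (W.trans (twistᵢ-cong d (H⁻¹⊗H d)) (twist-1 Q))) (W.*-identityˡ E)))))
          where E = H⁻¹ d

        v-fixed : ∀ n → v n ^ Q ≈ v n
        v-fixed n = begin
          v n ^ Q                                  ≈⟨ σ-⟪⟫ {Q} (frob^ d) (H⁻¹ d) s n ⟩
          ⟪ twist Q (H⁻¹ d) ⟫ (σ Q s) n            ≈⟨ ⟪⟫-cong (twist Q (H⁻¹ d)) (σs-B d) n ⟩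
          ⟪ twist Q (H⁻¹ d) ⟫ (⟪ B d ⟫ s) n        ≈⟨ onᵂ twist-H⁻¹ s-tor n ⟩
          v n                                      ∎

  -- Generators of the cyclotomic fields and the characteristic.

  generated-least : ∀ {a b} {X : Pred Carrier a} (K : Subfield b) → X ⊆ ⟦ K ⟧ → Generated X ⊆ ⟦ K ⟧
  generated-least K X⊆K (gen x∈X)    = X⊆K x∈X
  generated-least K X⊆K (resp x≈y x) = Subfield.respects K x≈y (generated-least K X⊆K x)
  generated-least K X⊆K zer          = Subfield.0-closed K
  generated-least K X⊆K one          = Subfield.1-closed K
  generated-least K X⊆K (add x y)    = Subfield.+-closed K (generated-least K X⊆K x) (generated-least K X⊆K y)
  generated-least K X⊆K (neg x)      = Subfield.neg-closed K (generated-least K X⊆K x)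
  generated-least K X⊆K (mul x y)    = Subfield.*-closed K (generated-least K X⊆K x) (generated-least K X⊆K y)
  generated-least K X⊆K (inv x xy≈1) = Subfield.inv-closed K (generated-least K X⊆K x) xy≈1

  open Mult semiring using (×1-homo-*; ×-homo-1) renaming (_×_ to _·_)

  -- Turns q · 1 = 0 into (p · 1)^r = 0, so that the characteristic is p.
  [p^r]·1≈[p·1]^r : ∀ p r → (p ℕ.^ r) · 1# ≈ (p · 1#) ^ r
  [p^r]·1≈[p·1]^r p zero    = ×-homo-1 1#
  [p^r]·1≈[p·1]^r p (suc r) = trans (×1-homo-* p (p ℕ.^ r)) (*-congˡ ([p^r]·1≈[p·1]^r p r))

open import Data.Nat using (_^_)

theorem1p1 : ∀ {c ℓ₁ ℓ₂ a b : Level} (p r q d : ℕ) → Prime p → 1 ≤ r → q ≡ p ^ r → 1 ≤ d →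
    (Ω : HeytingField c ℓ₁ ℓ₂) → Decidable (HeytingField._#_ Ω) →
    let open HeytingField Ω using (Carrier)
        open FieldTheory Ω
    in
    (𝔽q : Subfield a) → HasOrder 𝔽q q →
    (𝔽qᵈ : Subfield b) → HasOrder 𝔽qᵈ (q ^ d) →
    (T : Carrier) → Transcendental 𝔽q T → IsAlgebraicClosureOf (𝔽q ⟨ T ⟩) →
    let open Carlitz T
    in
    (M : Poly) → M ∈ 𝔽q [X] → Nonzero M → Splits 𝔽qᵈ M →
    ⟦ cyclotomic q 𝔽q M ⟧ ⊆ ⟦ cyclotomic (q ^ d) 𝔽qᵈ M ⟧
theorem1p1 p r q d pp 1≤r ≡.refl 1≤d Ω _#?_ 𝔽q order-q 𝔽qᵈ order-qᵈ T T-trans closure M M∈𝔽q[X] M-nonzero splits =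
  generated-least K λ
    { (inj₁ x∈𝔽q⟨T⟩) → generated-least K (λ { (inj₁ x∈𝔽q) → 𝔽qᵈ⊆K (𝔽q⊆𝔽qᵈ x∈𝔽q) ; (inj₂ ≡.refl) → T∈K }) x∈𝔽q⟨T⟩
    ; (inj₂ u-tor) → torsion-q⊆K M (IsAlgebraicClosureOf.algebraicallyClosed closure) q d 2≤q 1≤d frob
        (All.map Fq.x∈k⇒x^n≈x M∈𝔽q[X]) 𝔽qᵈ (Fqᵈ.x^n≈x⇒x∈k 2≤qᵈ , Fqᵈ.x∈k⇒x^n≈x)
        T (λ T∈𝔽qᵈ → transcendental⇒x^n≉x 𝔽q T-trans 2≤qᵈ (Fqᵈ.x∈k⇒x^n≈x T∈𝔽qᵈ))
        M-nonzero splits K 𝔽qᵈ⊆K T∈K (λ u∈tor → gen (inj₂ u∈tor)) u-tor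
    }
  where
  open FieldTheory Ω
  open FieldProperties Ω _#?_
  open CarlitzTorsion Ω _#?_
  open HeytingField Ω using (trans; sym; heytingCommutativeRing)
  open CommutativeRing (HeytingCommutativeRing.commutativeRing heytingCommutativeRing) using (commutativeSemiring)
  open Frobenius commutativeSemiring
  open Carlitz T
  module Fq = FiniteField 𝔽q order-q
  module Fqᵈ = FiniteField 𝔽qᵈ order-qᵈ

  2≤q : 2 ≤ q
  2≤q = 2≤n^m (ℕ.nonTrivial⇒n>1 p {{prime⇒nonTrivial pp}}) 1≤r

  2≤qᵈ : 2 ≤ q ^ d
  2≤qᵈ = 2≤n^m 2≤q 1≤d

  frob : AdditivePower q
  frob = additivePower-^ {p} (^p-distrib-+ pp (x^n≈0⇒x≈0 r (trans (sym ([p^r]·1≈[p·1]^r p r)) Fq.n·1≈0))) r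

  K = cyclotomic (q ^ d) 𝔽qᵈ M

  -- The two finite fields are given separately inside Ω; their inclusion comes from x^q = x
  -- implying x^(q^d) = x.
  𝔽q⊆𝔽qᵈ : ⟦ 𝔽q ⟧ ⊆ ⟦ 𝔽qᵈ ⟧
  𝔽q⊆𝔽qᵈ x∈𝔽q = Fqᵈ.x^n≈x⇒x∈k 2≤qᵈ (^-fixed (Fq.x∈k⇒x^n≈x x∈𝔽q) d)

  𝔽qᵈ⊆K : ⟦ 𝔽qᵈ ⟧ ⊆ ⟦ K ⟧
  𝔽qᵈ⊆K x∈𝔽qᵈ = gen (inj₁ (gen (inj₁ x∈𝔽qᵈ)))

  T∈K : T ∈ ⟦ K ⟧
  T∈K = gen (inj₁ (gen (inj₂ ≡.refl)))
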